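{- Let $\Lambda=\Delta-\Psi$ be the zeon combinatorial Laplacian of a simple graph on $m$ vertices, and let $\Lambda_{\rm sym}=\Delta-(\Psi+\Psi^\dagger)$. If $\lambda$ is the zeon eigenvalue of $\Lambda$ associated with a vertex of unique degree $d=\mathfrak{C}\lambda$, then $\lambda_*=\mathfrak{C}\lambda+2\,\mathfrak{D}\lambda$ is the unique zeon eigenvalue of $\Lambda_{\rm sym}$ satisfying $\mathfrak{C}\lambda_*=\mathfrak{C}\lambda$.
   Context: Zeon algebra: $\mathbb{C}\mathfrak{Z}$ is the commutative unital complex algebra generated by $\zeta_{\{i\}}$, $i\in\mathbb{N}=\{1,2,\ldots\}$, and the scalar $1=\zeta_\varnothing$, with $\zeta_{\{i\}}\zeta_{\{j\}}=\zeta_{\{j\}}\zeta_{\{i\}}=\zeta_{\{i,j\}}$ for $i\neq j$ and $\zeta_{\{i\}}^2=0$. For finite $I\subset\mathbb{N}$, $\zeta_I=\prod_{i\in I}\zeta_{\{i\}}$; the $\zeta_I$ form a vector space basis. For $u=\sum_I u_I\zeta_I$, the scalar part is $\mathfrak{C}u=u_\varnothing$, the dual (nilpotent) part is $\mathfrak{D}u=u-\mathfrak{C}u$, and $\overline{u}=\sum_I\overline{u_I}\zeta_I$. For a matrix $A$ over $\mathbb{C}\mathfrak{Z}$, $A^\dagger=\overline{A}^{\intercal}$ is the conjugate transpose. Eigenvalues: for $A\in\mathrm{Mat}(m,\mathbb{C}\mathfrak{Z})$, $\lambda\in\mathbb{C}\mathfrak{Z}$ is a (zeon) eigenvalue if $A\xi=\lambda\xi$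 for some non-null $\xi\in\mathbb{C}\mathfrak{Z}^m$ (non-null: $\mathfrak{C}(\xi^\dagger\xi)\neq0$; equivalently some component of $\xi$ has nonzero scalar part). Graphs: for a simple finite graph with vertices $v_1,\ldots,v_m$ and edge set $E$, the nilpotent adjacency matrix $\Psi=(\psi_{ij})$ has $\psi_{ij}=\zeta_{\{j\}}$ if $\{v_i,v_j\}\in E$ and $\psi_{ij}=0$ otherwise; $\Delta=\mathrm{diag}(\deg v_1,\ldots,\deg v_m)$; $\Lambda=\Delta-\Psi$. A vertex is of unique degree $d$ if it is the only vertex of degree $d$; the eigenvalue of $\Lambda$ associated with that vertex is the unique eigenvalue $\lambda$ of $\Lambda$ with $\mathfrak{C}\lambda=d$. -}

module Defs where

open import Data.Bool.Base using (Bool; false; if_then_else_)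
open import Data.Bool.Properties using () renaming (_≟_ to _≟ᵇ_)
open import Data.Fin.Base using (Fin)
open import Data.Fin.Properties using () renaming (_≟_ to _≟ᶠ_)
open import Data.Fin.Subset using (Subset; inside; outside; ⁅_⁆; ∣_∣)
open import Data.Integer.Base using (+_)
open import Data.Nat.Base as ℕ using (ℕ; zero; suc; _⊔_)
import Data.Nat.Properties as ℕₚ
open import Data.Product.Base using (_×_; _,_; ∃-syntax; proj₁; proj₂)
open import Data.Rational.Base as ℚ using (ℚ; 0ℚ; 1ℚ; ½; _<_; _≤_; 1/_)
import Data.Rational.Properties as ℚₚ
open import Data.Rational.Solver using (module +-*-Solver)
open import Data.Vec.Base using ([]; _∷_; tabulate)
open import Data.Vec.Functional using (Vector; foldr)
open import Data.Vec.Properties using (≡-dec)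
open import Relation.Binary.PropositionalEquality
open import Relation.Nullary using (¬_; does)

-- Real numbers: Cauchy sequences of rationals, with the operations taken
-- termwise and equality meaning that the difference tends to 0.

∣_∣ℚ : ℚ → ℚ
∣_∣ℚ = ℚ.∣_∣

IsCauchy : (ℕ → ℚ) → Set
IsCauchy s = ∀ ε → 0ℚ < ε →
  ∃[ N ] (∀ m n → N ℕ.≤ m → N ℕ.≤ n → ∣ s m ℚ.- s n ∣ℚ < ε)

record ℝ : Set where
  constructor mkℝ
  field
    seq    : ℕ → ℚ
    cauchy : IsCauchy seq

open ℝ public

infix 4 _≈ℝ_

record _≈ℝ_ (x y : ℝ) : Set where
  constructor mk≈ℝ
  field
    close : ∀ ε → 0ℚ < ε →
      ∃[ N ] (∀ n → N ℕ.≤ n → ∣ seq x n ℚ.- seq y n ∣ℚ < ε)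

private
  half>0 : ∀ {ε} → 0ℚ < ε → 0ℚ < ½ ℚ.* ε
  half>0 {ε} ε>0 = subst (_< ½ ℚ.* ε) (ℚₚ.*-zeroʳ ½) (ℚₚ.*-monoʳ-<-pos ½ ε>0)

  half+half : ∀ ε → ½ ℚ.* ε ℚ.+ ½ ℚ.* ε ≡ ε
  half+half ε = trans (sym (ℚₚ.*-distribʳ-+ ε ½ ½)) (ℚₚ.*-identityˡ ε)

  fraction : ∀ B ε → 0ℚ < B → 0ℚ < ε → ∃[ δ ] (0ℚ < δ × B ℚ.* δ ≡ ε)
  fraction B ε B>0 ε>0 = δ , δ>0 , B*δ≡ε
    where
    instance
      _ = ℚ.positive B>0
      _ = ℚ.positive ε>0
      _ = ℚₚ.pos⇒nonZero B
      _ = ℚₚ.1/pos⇒pos B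
    δ = 1/ B ℚ.* ε
    δ>0 : 0ℚ < δ
    δ>0 = ℚₚ.positive⁻¹ δ {{ℚₚ.pos*pos⇒pos (1/ B) ε}}
    B*δ≡ε : B ℚ.* δ ≡ ε
    B*δ≡ε = trans (sym (ℚₚ.*-assoc B (1/ B) ε))
      (trans (cong (ℚ._* ε) (ℚₚ.*-inverseʳ B)) (ℚₚ.*-identityˡ ε))

  Bound : (ℕ → ℚ) → Set
  Bound s = ∃[ B ] (0ℚ < B × ∃[ N ] (∀ n → N ℕ.≤ n → ∣ s n ∣ℚ ≤ B))

  -- Projections rather than 'with': abstracting would normalise the goal,
  -- which is very slow for rational arithmetic.

  bounded : ∀ s → IsCauchy s → Bound s
  bounded s c = 1ℚ ℚ.+ ∣ s N ∣ℚ , B>0 , N , bnd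
    where
    open ℚₚ.≤-Reasoning
    N = proj₁ (c 1ℚ (ℚₚ.positive⁻¹ 1ℚ))
    h = proj₂ (c 1ℚ (ℚₚ.positive⁻¹ 1ℚ))
    B>0 : 0ℚ < 1ℚ ℚ.+ ∣ s N ∣ℚ
    B>0 = ℚₚ.+-mono-<-≤ (ℚₚ.positive⁻¹ 1ℚ) (ℚₚ.0≤∣p∣ (s N))
    split : ∀ a b → a ≡ (a ℚ.- b) ℚ.+ b
    split = solve 2 (λ a b → a := (a :- b) :+ b) refl
      where open +-*-Solver
    bnd : ∀ n → N ℕ.≤ n → ∣ s n ∣ℚ ≤ 1ℚ ℚ.+ ∣ s N ∣ℚ
    bnd n N≤n = begin
      ∣ s n ∣ℚ                           ≡⟨ cong ∣_∣ℚ (split (s n) (s N)) ⟩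
      ∣ (s n ℚ.- s N) ℚ.+ s N ∣ℚ         ≤⟨ ℚₚ.∣p+q∣≤∣p∣+∣q∣ (s n ℚ.- s N) (s N) ⟩
      ∣ s n ℚ.- s N ∣ℚ ℚ.+ ∣ s N ∣ℚ
        ≤⟨ ℚₚ.+-monoˡ-≤ ∣ s N ∣ℚ (ℚₚ.<⇒≤ (h n N N≤n ℕₚ.≤-refl)) ⟩
      1ℚ ℚ.+ ∣ s N ∣ℚ                    ∎

  const-cauchy : ∀ q → IsCauchy (λ _ → q)
  const-cauchy q ε ε>0 = 0 , λ _ _ _ _ →
    subst (_< ε) (sym (cong ∣_∣ℚ (ℚₚ.+-inverseʳ q))) ε>0

  +-cauchy : ∀ s t → IsCauchy s → IsCauchy t → IsCauchy (λ n → s n ℚ.+ t n)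
  +-cauchy s t cs ct ε ε>0 = M ⊔ N , λ m n m≥ n≥ → begin-strict
      ∣ (s m ℚ.+ t m) ℚ.- (s n ℚ.+ t n) ∣ℚ
        ≡⟨ cong ∣_∣ℚ (shuffle (s m) (t m) (s n) (t n)) ⟩
      ∣ (s m ℚ.- s n) ℚ.+ (t m ℚ.- t n) ∣ℚ
        ≤⟨ ℚₚ.∣p+q∣≤∣p∣+∣q∣ (s m ℚ.- s n) (t m ℚ.- t n) ⟩
      ∣ s m ℚ.- s n ∣ℚ ℚ.+ ∣ t m ℚ.- t n ∣ℚ
        <⟨ ℚₚ.+-mono-< (hs m n (ℕₚ.m⊔n≤o⇒m≤o M N m≥) (ℕₚ.m⊔n≤o⇒m≤o M N n≥))
                       (ht m n (ℕₚ.m⊔n≤o⇒n≤o M N m≥) (ℕₚ.m⊔n≤o⇒n≤o M N n≥)) ⟩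
      ½ ℚ.* ε ℚ.+ ½ ℚ.* ε
        ≡⟨ half+half ε ⟩
      ε ∎
    where
    open ℚₚ.≤-Reasoning
    S = cs (½ ℚ.* ε) (half>0 ε>0)
    T = ct (½ ℚ.* ε) (half>0 ε>0)
    M = proj₁ S
    N = proj₁ T
    hs = proj₂ S
    ht = proj₂ T
    shuffle : ∀ a b c d → (a ℚ.+ b) ℚ.- (c ℚ.+ d) ≡ (a ℚ.- c) ℚ.+ (b ℚ.- d)
    shuffle = solve 4 (λ a b c d → (a :+ b) :- (c :+ d) := (a :- c) :+ (b :- d)) refl
      where open +-*-Solver

  neg-cauchy : ∀ s → IsCauchy s → IsCauchy (λ n → ℚ.- s n)
  neg-cauchy s cs ε ε>0 = proj₁ (cs ε ε>0) , λ m n m≥ n≥ →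
      subst (_< ε) (sym (trans (cong ∣_∣ℚ (flip (s m) (s n))) (ℚₚ.∣-p∣≡∣p∣ (s m ℚ.- s n))))
        (proj₂ (cs ε ε>0) m n m≥ n≥)
    where
    flip : ∀ a b → (ℚ.- a) ℚ.- (ℚ.- b) ≡ ℚ.- (a ℚ.- b)
    flip = solve 2 (λ a b → (:- a) :- (:- b) := :- (a :- b)) refl
      where open +-*-Solver

  scaled : ∀ a b B δ → 0ℚ < B → ∣ a ∣ℚ ≤ B → ∣ b ∣ℚ < δ → ∣ a ℚ.* b ∣ℚ < B ℚ.* δ
  scaled a b B δ B>0 a≤B b<δ = begin-strict
      ∣ a ℚ.* b ∣ℚ        ≡⟨ ℚₚ.∣p*q∣≡∣p∣*∣q∣ a b ⟩
      ∣ a ∣ℚ ℚ.* ∣ b ∣ℚ   ≤⟨ ℚₚ.*-monoʳ-≤-nonNeg ∣ b ∣ℚ {{ℚ.nonNegative (ℚₚ.0≤∣p∣ b)}} a≤B ⟩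
      B ℚ.* ∣ b ∣ℚ        <⟨ ℚₚ.*-monoʳ-<-pos B {{ℚ.positive B>0}} b<δ ⟩
      B ℚ.* δ             ∎
    where open ℚₚ.≤-Reasoning

  *-cauchy : ∀ s t → IsCauchy s → IsCauchy t → IsCauchy (λ n → s n ℚ.* t n)
  *-cauchy s t cs ct ε ε>0 =
    let B , B>0 , K , bs = bounded s cs
        C , C>0 , L , bt = bounded t ct
        β , β>0 , Bβ     = fraction B (½ ℚ.* ε) B>0 (half>0 ε>0)
        γ , γ>0 , Cγ     = fraction C (½ ℚ.* ε) C>0 (half>0 ε>0)
        M , ht           = ct β β>0
        N , hs           = cs γ γ>0
    in (K ⊔ L) ⊔ (M ⊔ N) , λ m n m≥ n≥ →
      let KL≤m = ℕₚ.m⊔n≤o⇒m≤o (K ⊔ L) (M ⊔ N) m≥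
          KL≤n = ℕₚ.m⊔n≤o⇒m≤o (K ⊔ L) (M ⊔ N) n≥
          MN≤m = ℕₚ.m⊔n≤o⇒n≤o (K ⊔ L) (M ⊔ N) m≥
          MN≤n = ℕₚ.m⊔n≤o⇒n≤o (K ⊔ L) (M ⊔ N) n≥
      in begin-strict
      ∣ s m ℚ.* t m ℚ.- s n ℚ.* t n ∣ℚ
        ≡⟨ cong ∣_∣ℚ (shuffle (s m) (t m) (s n) (t n)) ⟩
      ∣ s m ℚ.* (t m ℚ.- t n) ℚ.+ t n ℚ.* (s m ℚ.- s n) ∣ℚ
        ≤⟨ ℚₚ.∣p+q∣≤∣p∣+∣q∣ (s m ℚ.* (t m ℚ.- t n)) (t n ℚ.* (s m ℚ.- s n)) ⟩
      ∣ s m ℚ.* (t m ℚ.- t n) ∣ℚ ℚ.+ ∣ t n ℚ.* (s m ℚ.- s n) ∣ℚ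
        <⟨ ℚₚ.+-mono-<
             (scaled (s m) (t m ℚ.- t n) B β B>0
               (bs m (ℕₚ.m⊔n≤o⇒m≤o K L KL≤m))
               (ht m n (ℕₚ.m⊔n≤o⇒m≤o M N MN≤m) (ℕₚ.m⊔n≤o⇒m≤o M N MN≤n)))
             (scaled (t n) (s m ℚ.- s n) C γ C>0
               (bt n (ℕₚ.m⊔n≤o⇒n≤o K L KL≤n))
               (hs m n (ℕₚ.m⊔n≤o⇒n≤o M N MN≤m) (ℕₚ.m⊔n≤o⇒n≤o M N MN≤n))) ⟩
      B ℚ.* β ℚ.+ C ℚ.* γ
        ≡⟨ cong₂ ℚ._+_ Bβ Cγ ⟩
      ½ ℚ.* ε ℚ.+ ½ ℚ.* ε
        ≡⟨ half+half ε ⟩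
      ε ∎
    where
    open ℚₚ.≤-Reasoning
    shuffle : ∀ a b c d → a ℚ.* b ℚ.- c ℚ.* d ≡ a ℚ.* (b ℚ.- d) ℚ.+ d ℚ.* (a ℚ.- c)
    shuffle = solve 4 (λ a b c d → a :* b :- c :* d := a :* (b :- d) :+ d :* (a :- c)) refl
      where open +-*-Solver

infixl 6 _+ℝ_ _-ℝ_
infixl 7 _*ℝ_
infix  8 -ℝ_

ℚ→ℝ : ℚ → ℝ
ℚ→ℝ q = mkℝ (λ _ → q) (const-cauchy q)

-ℝ_ : ℝ → ℝ
-ℝ x = mkℝ (λ n → ℚ.- seq x n) (neg-cauchy (seq x) (cauchy x))

_+ℝ_ _-ℝ_ _*ℝ_ : ℝ → ℝ → ℝ
x +ℝ y = mkℝ (λ n → seq x n ℚ.+ seq y n) (+-cauchy (seq x) (seq y) (cauchy x) (cauchy y))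
x -ℝ y = x +ℝ (-ℝ y)
x *ℝ y = mkℝ (λ n → seq x n ℚ.* seq y n) (*-cauchy (seq x) (seq y) (cauchy x) (cauchy y))

infixr 5 _+i_

record ℂ : Set where
  constructor _+i_
  field
    re im : ℝ

open ℂ public

infix  4 _≈ℂ_
infixl 6 _+ℂ_
infixl 7 _*ℂ_
infix  8 -ℂ_

_≈ℂ_ : ℂ → ℂ → Set
z ≈ℂ w = re z ≈ℝ re w × im z ≈ℝ im w

_+ℂ_ _*ℂ_ : ℂ → ℂ → ℂ
z +ℂ w = (re z +ℝ re w) +i (im z +ℝ im w)
z *ℂ w = (re z *ℝ re w -ℝ im z *ℝ im w) +i (re z *ℝ im w +ℝ im z *ℝ re w)

-ℂ_ conjℂ : ℂ → ℂ
-ℂ z    = (-ℝ re z) +i (-ℝ im z)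
conjℂ z = re z +i (-ℝ im z)

ℕ→ℂ : ℕ → ℂ
ℕ→ℂ n = ℚ→ℝ (+ n ℚ./ 1) +i ℚ→ℝ 0ℚ

0ℂ 1ℂ : ℂ
0ℂ = ℕ→ℂ 0
1ℂ = ℕ→ℂ 1

-- The zeon algebra on countably many generators.
--
-- An element is a finite linear combination Σ_I u_I ζ_I; since it involves
-- only finitely many generators, it is stored as some n together with the
-- coefficients u_I for the subsets I of the first n generators.  Generators
-- are numbered from 0, so i : Fin n stands for the generator ζ_{i+1}.

record Zeon : Set where
  constructor zeon
  field
    gens : ℕ
    poly : Subset gens → ℂ

-- Read the coefficient of ζ_I for I among the first N generators, where N
-- need not be n: as finite subsets of ℕ, I and I ∷ʳ outside are the same,
-- and the coefficient is 0 when I contains a generator beyond the first n.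

extend : ∀ {n N} → (Subset n → ℂ) → Subset N → ℂ
extend {zero}  f []            = f []
extend {zero}  f (outside ∷ I) = extend f I
extend {zero}  f (inside  ∷ I) = 0ℂ
extend {suc n} f []            = extend (λ J → f (outside ∷ J)) []
extend {suc n} f (s ∷ I)       = extend (λ J → f (s ∷ J)) I

coeff : Zeon → ∀ {N} → Subset N → ℂ
coeff u = extend (Zeon.poly u)

infix  4 _≈_ _≈ᵛ_
infixl 6 _+_ _-_
infixl 7 _*_
infix  8 -_

record _≈_ (u v : Zeon) : Set where
  constructor mk≈
  field
    coeffs : ∀ {N} (I : Subset N) → coeff u I ≈ℂ coeff v I

-- (f ⋆ g) I = Σ f J · g K over the pairs (J , K) of disjoint sets with
-- J ∪ K = I: each generator of I lies in exactly one of J and K.  This is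
-- the product determined by ζ_J ζ_K = ζ_{J ∪ K} for disjoint J, K and
-- ζ_J ζ_K = 0 otherwise.

_⋆_ : ∀ {n} → (Subset n → ℂ) → (Subset n → ℂ) → Subset n → ℂ
(f ⋆ g) []            = f [] *ℂ g []
(f ⋆ g) (outside ∷ I) = ((λ J → f (outside ∷ J)) ⋆ (λ K → g (outside ∷ K))) I
(f ⋆ g) (inside  ∷ I) = ((λ J → f (inside  ∷ J)) ⋆ (λ K → g (outside ∷ K))) I
                     +ℂ ((λ J → f (outside ∷ J)) ⋆ (λ K → g (inside  ∷ K))) I

ι : ℂ → Zeon
ι z = zeon 0 (λ _ → z)

ζ : ∀ {n} → Subset n → Zeon
ζ {n} I = zeon n (λ J → if does (≡-dec _≟ᵇ_ J I) then 1ℂ else 0ℂ)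

0# : Zeon
0# = ι 0ℂ

-_ conj : Zeon → Zeon
- u    = zeon (Zeon.gens u) (λ I → -ℂ Zeon.poly u I)
conj u = zeon (Zeon.gens u) (λ I → conjℂ (Zeon.poly u I))

_+_ _*_ _-_ : Zeon → Zeon → Zeon
u + v  = zeon (Zeon.gens u ⊔ Zeon.gens v) (λ I → coeff u I +ℂ coeff v I)
u * v  = zeon (Zeon.gens u ⊔ Zeon.gens v) (coeff u ⋆ coeff v)
u - v  = u + (- v)

𝔠 : Zeon → ℂ
𝔠 u = coeff u {0} []

𝔇 : Zeon → Zeon
𝔇 u = u - ι (𝔠 u)

∑ : ∀ {m} → Vector Zeon m → Zeon
∑ = foldr _+_ 0#

_≈ᵛ_ : ∀ {m} → Vector Zeon m → Vector Zeon m → Set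
ξ ≈ᵛ η = ∀ i → ξ i ≈ η i

Matrix : ℕ → Set
Matrix m = Fin m → Fin m → Zeon

infixl 6 _+ᴹ_ _-ᴹ_
infixr 7 _*ᵛ_ _·ᵛ_
infix  9 _†

_+ᴹ_ _-ᴹ_ : ∀ {m} → Matrix m → Matrix m → Matrix m
(A +ᴹ B) i j = A i j + B i j
(A -ᴹ B) i j = A i j - B i j

_† : ∀ {m} → Matrix m → Matrix m
(A †) i j = conj (A j i)

diag : ∀ {m} → Vector Zeon m → Matrix m
diag d i j = if does (i ≟ᶠ j) then d i else 0#

_*ᵛ_ : ∀ {m} → Matrix m → Vector Zeon m → Vector Zeon m
(A *ᵛ ξ) i = ∑ (λ j → A i j * ξ j)

_·ᵛ_ : ∀ {m} → Zeon → Vector Zeon m → Vector Zeon m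
(u ·ᵛ ξ) i = u * ξ i

_†·_ : ∀ {m} → Vector Zeon m → Vector Zeon m → Zeon
ξ †· η = ∑ (λ i → conj (ξ i) * η i)

NonNull : ∀ {m} → Vector Zeon m → Set
NonNull ξ = ¬ (𝔠 (ξ †· ξ) ≈ℂ 0ℂ)

IsEigenvalue : ∀ {m} → Matrix m → Zeon → Set
IsEigenvalue {m} A u = ∃[ ξ ] (NonNull {m} ξ × A *ᵛ ξ ≈ᵛ u ·ᵛ ξ)

IsUniqueEigenvalueOver : ∀ {m} → Matrix m → ℂ → Zeon → Set
IsUniqueEigenvalueOver A z u =
    (IsEigenvalue A u × 𝔠 u ≈ℂ z)
  × (∀ μ → IsEigenvalue A μ → 𝔠 μ ≈ℂ z → μ ≈ u)

record SimpleGraph (m : ℕ) : Set where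
  field
    adj    : Fin m → Fin m → Bool
    symm   : ∀ i j → adj i j ≡ adj j i
    irrefl : ∀ i → adj i i ≡ false

  deg : Fin m → ℕ
  deg i = ∣ tabulate (adj i) ∣

  HasUniqueDegree : Fin m → Set
  HasUniqueDegree v = ∀ w → deg w ≡ deg v → w ≡ v

  Ψ Δ Λ Λsym : Matrix m
  Ψ i j = if adj i j then ζ ⁅ j ⁆ else 0#
  Δ     = diag (λ i → ι (ℕ→ℂ (deg i)))
  Λ     = Δ -ᴹ Ψ
  Λsym  = Δ -ᴹ (Ψ +ᴹ Ψ †)

{-# OPTIONS --safe #-}
module Submission where

-- Let d be the degree of v, e the unit vector at v, s = ζ_v, z = diag(ζ),
-- N = -A for the adjacency matrix A, and c = Δ - d, which is invertible away
-- from v.  Adding terms z_k B_k with z_k² = 0 to a matrix preserves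
-- invertibility, so there are vectors x, y, t vanishing at v such that, at all
-- other vertices,
--   c x + N z x = - N e,   c y + N z y = g x,   c t + N z t + z N t = - N e,
-- where g = (N z x)_v.  Then q = e + z (x + s y) is a left eigenvector of Λ for
-- d + s g, and η = e + z (x + 2 s y) + s t is an eigenvector of the symmetric
-- matrix Λsym for d + 2 s g: the two summands s g come from (N z x)_v and from
-- (N z t)_v, which agree because N is self-adjoint.
-- If q is a left and ξ a right eigenvector, for λ and μ, then
-- (μ - λ) (q · ξ) = 0.  When λ and μ both have scalar part d, the scalar part of
-- q · ξ is that of ξ_v, which is nonzero, and μ = λ follows coefficientwise.

open import Algebra.Bundles using (CommutativeRing)
open import Algebra.Structures using (IsCommutativeRing)
open import Data.Bool.Base using (true; false; if_then_else_)
open import Data.Bool.Properties using () renaming (_≟_ to _≟ᵇ_)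
open import Data.Fin.Base using (Fin; zero; suc)
open import Data.Fin.Properties using (_≟_)
open import Data.Fin.Subset as Subset using (Subset; inside; outside; ⁅_⁆)
open import Data.Integer.Base using (+_)
open import Data.Nat.Base as ℕ using (ℕ; zero; suc; _⊔_; z≤n; s≤s)
import Data.Nat.Properties as ℕₚ
open import Data.Product.Base using (_×_; _,_; ∃-syntax; proj₁; proj₂)
open import Data.Rational.Base as ℚ using (ℚ; 0ℚ; 1ℚ; ½; 1/_)
import Data.Rational.Properties as ℚₚ
open import Data.Rational.Solver using (module +-*-Solver)
open import Data.Sum.Base using (inj₁; inj₂; [_,_]′)
open import Data.Vec.Base using ([]; _∷_)
open import Data.Vec.Functional using (Vector; foldr; tail)
open import Data.Vec.Properties using (≡-dec)
open import Function.Base using (_∘_)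
open import Relation.Binary.PropositionalEquality as ≡ using (_≡_; _≢_; cong; cong₂; subst)
open import Relation.Binary.Bundles using (Setoid)
open import Relation.Binary.Structures using (IsEquivalence)
open import Relation.Nullary using (¬_; does; yes; no; contradiction)

-- Linear algebra over a commutative ring

-- The shape of `q` can be read off from its equation. Away from `v`, the left eigenvector equation
-- for `d + s g` is `(c - s g) q = - z N q`, which suggests `q = e + z p`. It then suffices that
-- `c p + N z p = s g p - N e`, and separating the terms without and with `s` in `p = x + s y` gives
-- the systems for `x` and `y`. For `Λsym` there is the further term `N z η`; as `z² = 0`, it is a
-- multiple of `s`, and `s t` is there to absorb it. Since `s² = 0`, doubling `s g` in the
-- eigenvalue leaves the systems for `x` and `t` alone and merely doubles `y`.
--
-- No right eigenvector of `Λ` is constructed: the hypothesis supplies one, and its pairing with `q`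
-- already determines the eigenvalue.
--
-- The obstacle below this algebra is constructive. Being nonzero is a mere negation for these
-- complex numbers, and it yields no inverse. Hence `q · ξ` is cancelled, never inverted; the only
-- complex numbers that have to be inverted are differences of degrees, which are rational.

module SubsetAlgebra {c ℓ} (K : CommutativeRing c ℓ) where
  open CommutativeRing K
  open import Algebra.Properties.CommutativeSemigroup
    (CommutativeRing.+-commutativeSemigroup K) using (interchange)
  open import Algebra.Properties.Group +-group using (ε⁻¹≈ε)
  open import Relation.Binary.Reasoning.Setoid setoid

  infix 4 _≐_
  infixl 7 _⊛_

  _≐_ : ∀ {n} (f g : Subset n → Carrier) → Set _
  f ≐ g = ∀ I → f I ≈ g I

  -- The zeon product over an abstract coefficient ring. Read `f` as `f₀ + f₁ ζ` in the first
  -- generator `ζ`: the clauses are the two coefficients of a product modulo `ζ² = 0`.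
  _⊛_ : ∀ {n} (f g : Subset n → Carrier) → Subset n → Carrier
  (f ⊛ g) []            = f [] * g []
  (f ⊛ g) (outside ∷ I) = ((f ∘ (outside ∷_)) ⊛ (g ∘ (outside ∷_))) I
  (f ⊛ g) (inside  ∷ I) = ((f ∘ (inside  ∷_)) ⊛ (g ∘ (outside ∷_))) I
                        + ((f ∘ (outside ∷_)) ⊛ (g ∘ (inside  ∷_))) I

  scalar : ∀ {n} → Carrier → Subset n → Carrier
  scalar z []            = z
  scalar z (outside ∷ I) = scalar z I
  scalar z (inside  ∷ I) = 0#

  ⊛-cong : ∀ {n} {f f′ g g′ : Subset n → Carrier} → f ≐ f′ → g ≐ g′ → f ⊛ g ≐ f′ ⊛ g′
  ⊛-cong p q []            = *-cong (p []) (q [])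
  ⊛-cong p q (outside ∷ I) = ⊛-cong (p ∘ (outside ∷_)) (q ∘ (outside ∷_)) I
  ⊛-cong p q (inside  ∷ I) = +-cong (⊛-cong (p ∘ (inside  ∷_)) (q ∘ (outside ∷_)) I)
                                    (⊛-cong (p ∘ (outside ∷_)) (q ∘ (inside  ∷_)) I)

  ⊛-comm : ∀ {n} (f g : Subset n → Carrier) → f ⊛ g ≐ g ⊛ f
  ⊛-comm f g []            = *-comm (f []) (g [])
  ⊛-comm f g (outside ∷ I) = ⊛-comm (f ∘ (outside ∷_)) (g ∘ (outside ∷_)) I
  ⊛-comm f g (inside  ∷ I) = trans
    (+-cong (⊛-comm (f ∘ (inside  ∷_)) (g ∘ (outside ∷_)) I)
            (⊛-comm (f ∘ (outside ∷_)) (g ∘ (inside  ∷_)) I))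
    (+-comm _ _)

  ⊛-distribʳ-+ : ∀ {n} (h f g : Subset n → Carrier) →
    (λ J → f J + g J) ⊛ h ≐ (λ I → (f ⊛ h) I + (g ⊛ h) I)
  ⊛-distribʳ-+ h f g []            = distribʳ (h []) (f []) (g [])
  ⊛-distribʳ-+ h f g (outside ∷ I) =
    ⊛-distribʳ-+ (h ∘ (outside ∷_)) (f ∘ (outside ∷_)) (g ∘ (outside ∷_)) I
  ⊛-distribʳ-+ h f g (inside  ∷ I) = trans
    (+-cong (⊛-distribʳ-+ (h ∘ (outside ∷_)) (f ∘ (inside  ∷_)) (g ∘ (inside  ∷_)) I)
            (⊛-distribʳ-+ (h ∘ (inside  ∷_)) (f ∘ (outside ∷_)) (g ∘ (outside ∷_)) I))
    (interchange _ _ _ _)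

  ⊛-distribˡ-+ : ∀ {n} (h f g : Subset n → Carrier) →
    h ⊛ (λ J → f J + g J) ≐ (λ I → (h ⊛ f) I + (h ⊛ g) I)
  ⊛-distribˡ-+ h f g I = trans (⊛-comm h _ I) (trans (⊛-distribʳ-+ h f g I)
    (+-cong (⊛-comm f h I) (⊛-comm g h I)))

  ⊛-zeroˡ : ∀ {n} {f : Subset n → Carrier} → (∀ I → f I ≈ 0#) → ∀ g I → (f ⊛ g) I ≈ 0#
  ⊛-zeroˡ p g []            = trans (*-congʳ (p [])) (zeroˡ (g []))
  ⊛-zeroˡ p g (outside ∷ I) = ⊛-zeroˡ (p ∘ (outside ∷_)) (g ∘ (outside ∷_)) I
  ⊛-zeroˡ p g (inside  ∷ I) = trans
    (+-cong (⊛-zeroˡ (p ∘ (inside  ∷_)) (g ∘ (outside ∷_)) I)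
            (⊛-zeroˡ (p ∘ (outside ∷_)) (g ∘ (inside  ∷_)) I))
    (+-identityˡ 0#)

  ⊛-zeroʳ : ∀ {n} {g : Subset n → Carrier} → (∀ I → g I ≈ 0#) → ∀ f I → (f ⊛ g) I ≈ 0#
  ⊛-zeroʳ {g = g} p f I = trans (⊛-comm f g I) (⊛-zeroˡ p f I)

  -- For a set containing the first generator, exactly one of the three factors takes that
  -- generator, so both bracketings expand to the same three products.
  ⊛-assoc : ∀ {n} (f g h : Subset n → Carrier) → (f ⊛ g) ⊛ h ≐ f ⊛ (g ⊛ h)
  ⊛-assoc f g h []            = *-assoc (f []) (g []) (h [])
  ⊛-assoc f g h (outside ∷ I) =
    ⊛-assoc (f ∘ (outside ∷_)) (g ∘ (outside ∷_)) (h ∘ (outside ∷_)) I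
  ⊛-assoc f g h (inside  ∷ I) = begin
    (((f ⊛ g) ∘ (inside ∷_)) ⊛ h₀) I + ((f₀ ⊛ g₀) ⊛ h₁) I
      ≈⟨ +-congʳ (⊛-distribʳ-+ h₀ (f₁ ⊛ g₀) (f₀ ⊛ g₁) I) ⟩
    (((f₁ ⊛ g₀) ⊛ h₀) I + ((f₀ ⊛ g₁) ⊛ h₀) I) + ((f₀ ⊛ g₀) ⊛ h₁) I
      ≈⟨ +-cong (+-cong (⊛-assoc f₁ g₀ h₀ I) (⊛-assoc f₀ g₁ h₀ I)) (⊛-assoc f₀ g₀ h₁ I) ⟩
    ((f₁ ⊛ (g₀ ⊛ h₀)) I + (f₀ ⊛ (g₁ ⊛ h₀)) I) + (f₀ ⊛ (g₀ ⊛ h₁)) I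
      ≈⟨ +-assoc _ _ _ ⟩
    (f₁ ⊛ (g₀ ⊛ h₀)) I + ((f₀ ⊛ (g₁ ⊛ h₀)) I + (f₀ ⊛ (g₀ ⊛ h₁)) I)
      ≈⟨ +-congˡ (⊛-distribˡ-+ f₀ (g₁ ⊛ h₀) (g₀ ⊛ h₁) I) ⟨
    (f₁ ⊛ (g₀ ⊛ h₀)) I + (f₀ ⊛ ((g ⊛ h) ∘ (inside ∷_))) I ∎
    where
    f₀ = f ∘ (outside ∷_)
    f₁ = f ∘ (inside ∷_)
    g₀ = g ∘ (outside ∷_)
    g₁ = g ∘ (inside ∷_)
    h₀ = h ∘ (outside ∷_)
    h₁ = h ∘ (inside ∷_)

  scalar-cong : ∀ {n} {x y} → x ≈ y → scalar {n} x ≐ scalar y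
  scalar-cong p []            = p
  scalar-cong p (outside ∷ I) = scalar-cong p I
  scalar-cong p (inside  ∷ I) = refl

  scalar-0 : ∀ {n} I → scalar {n} 0# I ≈ 0#
  scalar-0 []            = refl
  scalar-0 (outside ∷ I) = scalar-0 I
  scalar-0 (inside  ∷ I) = refl

  scalar-+ : ∀ {n} x y I → scalar {n} (x + y) I ≈ scalar x I + scalar y I
  scalar-+ x y []            = refl
  scalar-+ x y (outside ∷ I) = scalar-+ x y I
  scalar-+ x y (inside  ∷ I) = sym (+-identityˡ 0#)

  scalar-neg : ∀ {n} x I → scalar {n} (- x) I ≈ - scalar x I
  scalar-neg x []            = refl
  scalar-neg x (outside ∷ I) = scalar-neg x I
  scalar-neg x (inside  ∷ I) = sym ε⁻¹≈ε

  scalar-⊛ : ∀ {n} x (f : Subset n → Carrier) → scalar x ⊛ f ≐ (λ I → x * f I)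
  scalar-⊛ x f []            = refl
  scalar-⊛ x f (outside ∷ I) = scalar-⊛ x (f ∘ (outside ∷_)) I
  scalar-⊛ x f (inside  ∷ I) = trans
    (+-cong (⊛-zeroˡ (λ _ → refl) (f ∘ (outside ∷_)) I) (scalar-⊛ x (f ∘ (inside ∷_)) I))
    (+-identityˡ _)

  scalar-* : ∀ {n} x y → scalar {n} (x * y) ≐ (λ I → x * scalar y I)
  scalar-* x y []            = refl
  scalar-* x y (outside ∷ I) = scalar-* x y I
  scalar-* x y (inside  ∷ I) = sym (zeroʳ x)

  -- With `f = f₀ + f₁ ζ` and `g = g₀ + g₁ ζ`, the equation `f₀ g₀ = 0` gives `g₀ = 0` by induction,
  -- and then the coefficient `f₁ g₀ + f₀ g₁` of `ζ` reduces to `f₀ g₁ = 0`. The scalar part of `f₀`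
  -- is that of `f`. Cancellation in the coefficient ring is assumed in place of inverses.
  ⊛-cancel-≉0 : (∀ {x y} → x * y ≈ 0# → ¬ x ≈ 0# → y ≈ 0#) →
    ∀ {n} (f g : Subset n → Carrier) → (∀ I → (f ⊛ g) I ≈ 0#) → ¬ f Subset.⊥ ≈ 0# → ∀ I → g I ≈ 0#
  ⊛-cancel-≉0 cancel f g fg≈0 f≉0 []            = cancel (fg≈0 []) f≉0
  ⊛-cancel-≉0 cancel f g fg≈0 f≉0 (outside ∷ I) =
    ⊛-cancel-≉0 cancel (f ∘ (outside ∷_)) (g ∘ (outside ∷_)) (fg≈0 ∘ (outside ∷_)) f≉0 I
  ⊛-cancel-≉0 cancel f g fg≈0 f≉0 (inside  ∷ I) =
    ⊛-cancel-≉0 cancel f₀ (g ∘ (inside ∷_)) (λ J → begin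
      (f₀ ⊛ (g ∘ (inside ∷_))) J         ≈⟨ +-identityˡ _ ⟨
      0# + (f₀ ⊛ (g ∘ (inside ∷_))) J    ≈⟨ +-congʳ (⊛-zeroʳ g₀≈0 (f ∘ (inside ∷_)) J) ⟨
      (f ⊛ g) (inside ∷ J)               ≈⟨ fg≈0 (inside ∷ J) ⟩
      0#                                 ∎) f≉0 I
    where
    f₀ = f ∘ (outside ∷_)
    g₀≈0 : ∀ J → g (outside ∷ J) ≈ 0#
    g₀≈0 = ⊛-cancel-≉0 cancel f₀ (g ∘ (outside ∷_)) (fg≈0 ∘ (outside ∷_)) f≉0

-- Linear systems perturbed by nilsquare elements

module NilSquarePerturbation {c ℓ} (R : CommutativeRing c ℓ) where
  open CommutativeRing R hiding (zero)
  open import Algebra.Properties.Semiring.Sum semiring public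
    using (sum; sum-cong-≋; sum-replicate-zero; ∑-distrib-+; ∑-comm; *-distribˡ-sum)
  open import Algebra.Solver.Ring.NaturalCoefficients.Default commutativeSemiring
  open import Relation.Binary.Reasoning.Setoid setoid

  Vec Mat : ℕ → Set c
  Vec n = Fin n → Carrier
  Mat n = Fin n → Vec n

  infixr 7 _∙_

  _∙_ : ∀ {n} → Mat n → Vec n → Vec n
  (M ∙ x) i = sum (λ j → M i j * x j)

  _ᵀ : ∀ {n} → Mat n → Mat n
  (M ᵀ) i j = M j i

  diagonal : ∀ {n} → Vec n → Mat n
  diagonal c i j = if does (i ≟ j) then c i else 0#

  if-cong : ∀ b {x y} → x ≈ y → (if b then x else 0#) ≈ (if b then y else 0#)
  if-cong true  p = p
  if-cong false p = refl

  sum-if-≟ : ∀ {n} (i : Fin n) (f : Vec n) → sum (λ j → if does (i ≟ j) then f j else 0#) ≈ f i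
  sum-if-≟ {suc n} zero    f = trans (+-congˡ (sum-replicate-zero n)) (+-identityʳ (f zero))
  sum-if-≟ (suc i) f = trans (+-identityˡ _) (sum-if-≟ i (f ∘ suc))

  if-* : ∀ b x y → (if b then x else 0#) * y ≈ (if b then x * y else 0#)
  if-* true  x y = refl
  if-* false x y = zeroˡ y

  *-if : ∀ b x y → x * (if b then y else 0#) ≈ (if b then x * y else 0#)
  *-if true  x y = refl
  *-if false x y = zeroʳ x

  if-≟-intro : ∀ {n} {i j : Fin n} {x y} → (i ≡ j → x ≈ y) → (i ≢ j → x ≈ 0#) →
    x ≈ (if does (i ≟ j) then y else 0#)
  if-≟-intro {i = i} {j} p q with i ≟ j
  ... | yes i≡j = p i≡j
  ... | no  i≢j = q i≢j

  ∙-congˡ : ∀ {n} (M : Mat n) {x y : Vec n} → (∀ j → x j ≈ y j) → ∀ i → (M ∙ x) i ≈ (M ∙ y) i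
  ∙-congˡ {n} M p i = sum-cong-≋ {n} (λ j → *-congˡ (p j))

  ∙-congʳ : ∀ {n} {M N : Mat n} → (∀ i j → M i j ≈ N i j) → ∀ (x : Vec n) i → (M ∙ x) i ≈ (N ∙ x) i
  ∙-congʳ {n} p x i = sum-cong-≋ {n} (λ j → *-congʳ (p i j))

  ∙-+ : ∀ {n} (M : Mat n) (x y : Vec n) i → (M ∙ (λ j → x j + y j)) i ≈ (M ∙ x) i + (M ∙ y) i
  ∙-+ {n} M x y i = trans (sum-cong-≋ {n} (λ j → distribˡ (M i j) (x j) (y j))) (∑-distrib-+ {n} _ _)

  +-∙ : ∀ {n} (M N : Mat n) (x : Vec n) i → ((λ i j → M i j + N i j) ∙ x) i ≈ (M ∙ x) i + (N ∙ x) i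
  +-∙ {n} M N x i = trans (sum-cong-≋ {n} (λ j → distribʳ (x j) (M i j) (N i j))) (∑-distrib-+ {n} _ _)

  ∙-* : ∀ {n} (M : Mat n) z (x : Vec n) i → (M ∙ (λ j → z * x j)) i ≈ z * (M ∙ x) i
  ∙-* {n} M z x i = trans
    (sum-cong-≋ {n} (λ j → solve 3 (λ m z x → m :* (z :* x) := z :* (m :* x)) refl (M i j) z (x j)))
    (sym (*-distribˡ-sum {n} z _))

  *-∙ : ∀ {n} (M : Mat n) z (x : Vec n) i → ((λ i j → z * M i j) ∙ x) i ≈ z * (M ∙ x) i
  *-∙ {n} M z x i = trans (sum-cong-≋ {n} (λ j → *-assoc z (M i j) (x j))) (sym (*-distribˡ-sum {n} z _))

  diagonal-∙ : ∀ {n} (c x : Vec n) i → (diagonal c ∙ x) i ≈ c i * x i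
  diagonal-∙ {n} c x i = trans (sum-cong-≋ {n} (λ j → if-* (does (i ≟ j)) (c i) (x j)))
    (sum-if-≟ i (λ j → c i * x j))

  ∙-adjoint : ∀ {n} (M : Mat n) (x y : Vec n) → sum (λ i → x i * (M ∙ y) i) ≈ sum (λ j → y j * (M ᵀ ∙ x) j)
  ∙-adjoint {n} M x y = begin
    sum (λ i → x i * (M ∙ y) i)
      ≈⟨ sum-cong-≋ {n} (λ i → *-distribˡ-sum {n} (x i) (λ j → M i j * y j)) ⟩
    sum (λ i → sum (λ j → x i * (M i j * y j)))
      ≈⟨ ∑-comm {n} {n} (λ i j → x i * (M i j * y j)) ⟩
    sum (λ j → sum (λ i → x i * (M i j * y j)))
      ≈⟨ sum-cong-≋ {n} (λ j → trans
           (sum-cong-≋ {n} (λ i → solve 3 (λ x m y → x :* (m :* y) := y :* (m :* x)) refl (x i) (M i j) (y j)))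
           (sym (*-distribˡ-sum {n} (y j) (λ i → M i j * x i)))) ⟩
    sum (λ j → y j * (M ᵀ ∙ x) j) ∎

  -- Both sides are the pairing of `q` with `M ∙ ξ`.
  left-right-eigen : ∀ {n} (M : Mat n) {q ξ : Vec n} {λ₁ λ₂} →
    (∀ i → (M ᵀ ∙ q) i ≈ λ₁ * q i) → (∀ i → (M ∙ ξ) i ≈ λ₂ * ξ i) →
    λ₂ * sum (λ i → q i * ξ i) ≈ λ₁ * sum (λ i → q i * ξ i)
  left-right-eigen {n} M {q} {ξ} {λ₁} {λ₂} qM Mξ = begin
    λ₂ * sum (λ i → q i * ξ i)           ≈⟨ *-distribˡ-sum {n} λ₂ _ ⟩
    sum (λ i → λ₂ * (q i * ξ i))         ≈⟨ sum-cong-≋ {n} (λ i → trans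
      (solve 3 (λ l q x → l :* (q :* x) := q :* (l :* x)) refl λ₂ (q i) (ξ i)) (*-congˡ (sym (Mξ i)))) ⟩
    sum (λ i → q i * (M ∙ ξ) i)          ≈⟨ ∙-adjoint M q ξ ⟩
    sum (λ i → ξ i * (M ᵀ ∙ q) i)        ≈⟨ sum-cong-≋ {n} (λ i → trans (*-congˡ (qM i))
      (solve 3 (λ l q x → x :* (l :* q) := l :* (q :* x)) refl λ₁ (q i) (ξ i))) ⟩
    sum (λ i → λ₁ * (q i * ξ i))         ≈⟨ *-distribˡ-sum {n} λ₁ _ ⟨
    λ₁ * sum (λ i → q i * ξ i)           ∎

  -- Invertibility enters only as the existence of solutions, which spares matrix products and
  -- inverses.
  Solvable : ∀ {n} → Mat n → Set _
  Solvable {n} M = ∀ (b : Vec n) → ∃[ x ] (∀ i → (M ∙ x) i ≈ b i)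

  solvable-resp : ∀ {n} {M N : Mat n} → (∀ i j → M i j ≈ N i j) → Solvable M → Solvable N
  solvable-resp p S b = proj₁ (S b) , λ i →
    trans (∙-congʳ (λ i j → sym (p i j)) (proj₁ (S b)) i) (proj₂ (S b) i)

  solvable-diagonal : ∀ {n} {c : Vec n} → (∀ i → ∃[ r ] (r * c i ≈ 1#)) → Solvable (diagonal c)
  solvable-diagonal {c = c} inv b = (λ i → proj₁ (inv i) * b i) , λ i → begin
    (diagonal c ∙ (λ i → proj₁ (inv i) * b i)) i  ≈⟨ diagonal-∙ c _ i ⟩
    c i * (proj₁ (inv i) * b i)
      ≈⟨ solve 3 (λ c r b → c :* (r :* b) := (r :* c) :* b) refl (c i) (proj₁ (inv i)) (b i) ⟩
    (proj₁ (inv i) * c i) * b i                   ≈⟨ *-congʳ (proj₂ (inv i)) ⟩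
    1# * b i                                      ≈⟨ *-identityˡ (b i) ⟩
    b i                                           ∎

  -- (M + z B)⁻¹ = M⁻¹ - z M⁻¹ B M⁻¹ when z² = 0.
  solvable-perturb : ∀ {n} {M : Mat n} {z} B → z * z ≈ 0# → Solvable M →
    Solvable (λ i j → M i j + z * B i j)
  solvable-perturb {M = M} {z} B zz≈0 S b =
    let x  , Mx≈b   = S b
        x′ , Mx′≈Bx = S (λ i → - (B ∙ x) i)
    in (λ i → x i + z * x′ i) , λ i → begin
      ((λ i j → M i j + z * B i j) ∙ (λ i → x i + z * x′ i)) i
        ≈⟨ +-∙ M (λ i j → z * B i j) _ i ⟩
      (M ∙ (λ i → x i + z * x′ i)) i + ((λ i j → z * B i j) ∙ (λ i → x i + z * x′ i)) i
        ≈⟨ +-cong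
             (trans (∙-+ M x (λ i → z * x′ i) i) (+-cong (Mx≈b i) (trans (∙-* M z x′ i) (*-congˡ (Mx′≈Bx i)))))
             (trans (*-∙ B z _ i) (*-congˡ (trans (∙-+ B x (λ i → z * x′ i) i) (+-congˡ (∙-* B z x′ i))))) ⟩
      (b i + z * - (B ∙ x) i) + z * ((B ∙ x) i + z * (B ∙ x′) i)
        ≈⟨ solve 5 (λ b z n p q → (b :+ z :* n) :+ z :* (p :+ z :* q) := b :+ (z :* (n :+ p) :+ (z :* z) :* q))
             refl (b i) z (- (B ∙ x) i) ((B ∙ x) i) ((B ∙ x′) i) ⟩
      b i + (z * (- (B ∙ x) i + (B ∙ x) i) + (z * z) * (B ∙ x′) i)
        ≈⟨ +-congˡ (+-cong (trans (*-congˡ (-‿inverseˡ _)) (zeroʳ z)) (trans (*-congʳ zz≈0) (zeroˡ _))) ⟩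
      b i + (0# + 0#)  ≈⟨ trans (+-congˡ (+-identityˡ 0#)) (+-identityʳ (b i)) ⟩
      b i              ∎

  -- The products of different `z l` need not vanish. Each term is added to the matrix already
  -- perturbed by the earlier ones, so no expansion in all the `z l` at once is needed.
  solvable-perturbs : ∀ {n k} {M : Mat n} (z : Vec k) (B : Fin k → Mat n) →
    (∀ l → z l * z l ≈ 0#) → Solvable M → Solvable (λ i j → M i j + sum (λ l → z l * B l i j))
  solvable-perturbs {k = zero}  z B zz≈0 S = solvable-resp (λ i j → sym (+-identityʳ _)) S
  solvable-perturbs {k = suc k} z B zz≈0 S = solvable-resp (λ i j → +-assoc _ _ _)
    (solvable-perturbs (z ∘ suc) (B ∘ suc) (zz≈0 ∘ suc) (solvable-perturb (B zero) (zz≈0 zero) S))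

  solve-system : ∀ {n} {c z : Vec n} (P Q : Mat n) → (∀ i → ∃[ r ] (r * c i ≈ 1#)) →
    (∀ i → z i * z i ≈ 0#) → (b : Vec n) →
    ∃[ x ] (∀ i → c i * x i + ((P ∙ (λ j → z j * x j)) i + z i * (Q ∙ x) i) ≈ b i)
  solve-system {n} {c} {z} P Q inv zz≈0 b = x , λ i → trans (expand i) (proj₂ (S b) i)
    where
    -- The terms are grouped by the nilsquare element they contain: `z l` multiplies column `l` of
    -- `P` and row `l` of `Q`.
    B : Fin n → Mat n
    B l i j = (if does (j ≟ l) then P i j else 0#) + (if does (i ≟ l) then Q i j else 0#)
    collapse : ∀ i j → sum (λ l → z l * B l i j) ≈ z j * P i j + z i * Q i j
    collapse i j = begin
      sum (λ l → z l * B l i j)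
        ≈⟨ sum-cong-≋ {n} (λ l → trans (distribˡ (z l) _ _)
             (+-cong (*-if (does (j ≟ l)) (z l) (P i j)) (*-if (does (i ≟ l)) (z l) (Q i j)))) ⟩
      sum (λ l → (if does (j ≟ l) then z l * P i j else 0#) + (if does (i ≟ l) then z l * Q i j else 0#))
        ≈⟨ ∑-distrib-+ {n} _ _ ⟩
      sum (λ l → if does (j ≟ l) then z l * P i j else 0#) + sum (λ l → if does (i ≟ l) then z l * Q i j else 0#)
        ≈⟨ +-cong (sum-if-≟ j (λ l → z l * P i j)) (sum-if-≟ i (λ l → z l * Q i j)) ⟩
      z j * P i j + z i * Q i j ∎
    S : Solvable (λ i j → diagonal c i j + (z j * P i j + z i * Q i j))
    S = solvable-resp (λ i j → +-congˡ (collapse i j))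
      (solvable-perturbs z B zz≈0 (solvable-diagonal inv))
    x : Vec n
    x = proj₁ (S b)
    expand : ∀ i → c i * x i + ((P ∙ (λ j → z j * x j)) i + z i * (Q ∙ x) i) ≈
      ((λ i j → diagonal c i j + (z j * P i j + z i * Q i j)) ∙ x) i
    expand i = sym (begin
      ((λ i j → diagonal c i j + (z j * P i j + z i * Q i j)) ∙ x) i
        ≈⟨ +-∙ (diagonal c) (λ i j → z j * P i j + z i * Q i j) x i ⟩
      (diagonal c ∙ x) i + ((λ i j → z j * P i j + z i * Q i j) ∙ x) i
        ≈⟨ +-cong (diagonal-∙ c x i) (+-∙ (λ i j → z j * P i j) (λ i j → z i * Q i j) x i) ⟩
      c i * x i + (((λ i j → z j * P i j) ∙ x) i + ((λ i j → z i * Q i j) ∙ x) i)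
        ≈⟨ +-congˡ (+-cong
             (sum-cong-≋ {n} (λ j → solve 3 (λ z p x → (z :* p) :* x := p :* (z :* x)) refl (z j) (P i j) (x j)))
             (trans (sum-cong-≋ {n} (λ j → *-assoc (z i) (Q i j) (x j))) (sym (*-distribˡ-sum {n} (z i) _)))) ⟩
      c i * x i + ((P ∙ (λ j → z j * x j)) i + z i * (Q ∙ x) i) ∎)

-- Eigenvectors of the two Laplacians

-- D = d + c is the degree matrix and N is minus the adjacency matrix: no
-- subtraction occurs, so every identity below is one of commutative semirings.
module ZeonLaplacian {c ℓ} (R : CommutativeRing c ℓ) where
  open CommutativeRing R hiding (zero)
  open NilSquarePerturbation R
  open import Algebra.Solver.Ring.NaturalCoefficients.Default commutativeSemiring
  open import Algebra.Properties.Group +-group using (∙-cancelʳ; ε⁻¹≈ε)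
  open import Algebra.Properties.Ring ring using (-1*x≈-x)
  open import Relation.Binary.Reasoning.Setoid setoid

  Λ Λsym : ∀ {m} (D ζ : Vec m) (N : Mat m) → Mat m
  Λ    D ζ N i j = diagonal D i j + N i j * ζ j
  Λsym D ζ N i j = diagonal D i j + (N i j * ζ j + N j i * ζ i)

  neg-if : ∀ b x → - (if b then x else 0#) ≈ (if b then - 1# else 0#) * x
  neg-if true  x = sym (-1*x≈-x x)
  neg-if false x = trans ε⁻¹≈ε (sym (zeroˡ x))

  -- For `k` the scalar part of an eigenvalue `u` and `w` the number 2, the left side is the `λ_*`
  -- of the theorem.
  doubled-difference : ∀ {d k p u w} → w ≈ 1# + 1# → k ≈ d → u ≈ d + p →
    k + w * (u + - k) ≈ d + (p + p)
  doubled-difference {d} {k} {p} {u} {w} w≈2 k≈d u≈d+p = begin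
    k + w * (u + - k)
      ≈⟨ +-cong k≈d (*-cong w≈2 (+-cong u≈d+p (-‿cong k≈d))) ⟩
    d + (1# + 1#) * ((d + p) + - d)
      ≈⟨ +-congˡ (*-congˡ (trans (solve 3 (λ d p n → (d :+ p) :+ n := p :+ (d :+ n)) refl d p (- d))
           (trans (+-congˡ (-‿inverseʳ d)) (+-identityʳ p)))) ⟩
    d + (1# + 1#) * p
      ≈⟨ solve 2 (λ d p → d :+ (con 1 :+ con 1) :* p := d :+ (p :+ p)) refl d p ⟩
    d + (p + p) ∎

  module UniqueDegree {m} (v : Fin m) (d : Carrier) (c ζ : Vec m) (N : Mat m)
    (c-inv : ∀ w → w ≢ v → ∃[ r ] (r * c w ≈ 1#)) (cv≈0 : c v ≈ 0#)
    (ζζ≈0 : ∀ i → ζ i * ζ i ≈ 0#) (N-sym : ∀ i j → N i j ≈ N j i) (Nvv≈0 : N v v ≈ 0#) where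

    D e : Vec m
    D i = d + c i
    e j = if does (v ≟ j) then 1# else 0#

    mask : Vec m → Vec m
    mask f i = if does (i ≟ v) then 0# else f i

    mask-v : ∀ f → mask f v ≈ 0#
    mask-v f with v ≟ v
    ... | yes _   = refl
    ... | no  v≢v = contradiction ≡.refl v≢v

    mask-≢ : ∀ f {w} → w ≢ v → mask f w ≈ f w
    mask-≢ f {w} w≢v with w ≟ v
    ... | yes w≡v = contradiction w≡v w≢v
    ... | no  _   = refl

    -- This moves the deletion of coordinate `v` from the unknown to the coefficients, so that a
    -- system without `v` can be solved as one of full size.
    mask-*-comm : ∀ f g i → mask f i * g i ≈ f i * mask g i
    mask-*-comm f g i with i ≟ v
    ... | yes _ = trans (zeroˡ (g i)) (sym (zeroʳ (f i)))
    ... | no  _ = refl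

    infixr 8 ζ·_
    ζ·_ : Vec m → Vec m
    (ζ· x) j = ζ j * x j

    opaque
      -- Since `c v` vanishes, it is replaced by 1 and the coefficients coupling the other equations
      -- to coordinate `v` are masked. The full system is then solvable, and setting its solution to
      -- 0 at `v` changes no equation at the other vertices. The factor `κ` is 0 for the systems of
      -- `x` and `y` and 1 for that of `t`.
      reduced-system : ∀ κ (b : Vec m) → ∃[ x ] (x v ≈ 0# ×
        (∀ w → w ≢ v → c w * x w + ((N ∙ ζ· x) w + ζ w * (κ * (N ∙ x) w)) ≈ b w))
      reduced-system κ b = mask x , mask-v x , solves
        where
        c′ : Vec m
        c′ i = if does (i ≟ v) then 1# else c i
        c′-inv : ∀ i → ∃[ r ] (r * c′ i ≈ 1#)
        c′-inv i with i ≟ v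
        ... | yes _   = 1# , *-identityˡ 1#
        ... | no  i≢v = c-inv i i≢v
        nilsq : ∀ i → mask ζ i * mask ζ i ≈ 0#
        nilsq i with i ≟ v
        ... | yes _ = zeroˡ 0#
        ... | no  _ = ζζ≈0 i
        solution : ∃[ x ] (∀ i → c′ i * x i + ((N ∙ (λ j → mask ζ j * x j)) i +
          mask ζ i * ((λ i j → κ * mask (N i) j) ∙ x) i) ≈ b i)
        solution = solve-system N (λ i j → κ * mask (N i) j) c′-inv nilsq b
        x : Vec m
        x = proj₁ solution
        c′-≢ : ∀ {w} → w ≢ v → c w ≈ c′ w
        c′-≢ {w} w≢v with w ≟ v
        ... | yes w≡v = contradiction w≡v w≢v
        ... | no  _   = refl
        solves : ∀ w → w ≢ v →
          c w * mask x w + ((N ∙ ζ· mask x) w + ζ w * (κ * (N ∙ mask x) w)) ≈ b w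
        solves w w≢v = trans
          (+-cong (*-cong (c′-≢ w≢v) (mask-≢ x w≢v))
            (+-cong (∙-congˡ N (λ j → sym (mask-*-comm ζ x j)) w)
              (*-cong (sym (mask-≢ ζ w≢v)) (trans (sym (∙-* N κ (mask x) w))
                (sum-cong-≋ {m} (λ j → trans
                  (solve 3 (λ n k x → n :* (k :* x) := k :* (n :* x)) refl (N w j) κ (mask x j))
                  (trans (*-congˡ (sym (mask-*-comm (N w) x j))) (sym (*-assoc _ _ _)))))))))
          (proj₂ solution w)

    a : Vec m
    a i = N i v

    N∙e : ∀ i → (N ∙ e) i ≈ a i
    N∙e i = trans (sum-cong-≋ {m} (λ j → trans (*-if (does (v ≟ j)) (N i j) 1#)
        (if-cong (does (v ≟ j)) (*-identityʳ (N i j))))) (sum-if-≟ v (N i))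

    e-v : e v ≈ 1#
    e-v with v ≟ v
    ... | yes _   = refl
    ... | no  v≢v = contradiction ≡.refl v≢v

    e-≢ : ∀ {w} → w ≢ v → e w ≈ 0#
    e-≢ {w} w≢v with v ≟ w
    ... | yes v≡w = contradiction (≡.sym v≡w) w≢v
    ... | no  _   = refl

    s : Carrier
    s = ζ v

    x y t : Vec m
    g : Carrier

    x = proj₁ (reduced-system 0# (λ i → - a i))
    g = (N ∙ ζ· x) v
    y = proj₁ (reduced-system 0# (λ i → g * x i))
    t = proj₁ (reduced-system 1# (λ i → - a i))

    +-inverse : ∀ {p q} → p ≈ - q → p + q ≈ 0#
    +-inverse {p} {q} p≈-q = trans (+-congʳ p≈-q) (-‿inverseˡ q)

    xv≈0 : x v ≈ 0#
    xv≈0 = proj₁ (proj₂ (reduced-system 0# (λ i → - a i)))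

    yv≈0 : y v ≈ 0#
    yv≈0 = proj₁ (proj₂ (reduced-system 0# (λ i → g * x i)))

    tv≈0 : t v ≈ 0#
    tv≈0 = proj₁ (proj₂ (reduced-system 1# (λ i → - a i)))

    x-eq : ∀ w → w ≢ v → (c w * x w + (N ∙ ζ· x) w) + a w ≈ 0#
    x-eq w w≢v = +-inverse (trans
      (solve 4 (λ p z u k → p :+ u := p :+ (u :+ z :* (con 0 :* k))) refl (c w * x w) (ζ w) _ ((N ∙ x) w))
      (proj₂ (proj₂ (reduced-system 0# (λ i → - a i))) w w≢v))

    y-eq : ∀ w → w ≢ v → c w * y w + (N ∙ ζ· y) w ≈ g * x w
    y-eq w w≢v = trans
      (solve 4 (λ p z u k → p :+ u := p :+ (u :+ z :* (con 0 :* k))) refl (c w * y w) (ζ w) _ ((N ∙ y) w))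
      (proj₂ (proj₂ (reduced-system 0# (λ i → g * x i))) w w≢v)

    t-eq : ∀ w → w ≢ v → (c w * t w + ((N ∙ ζ· t) w + ζ w * (N ∙ t) w)) + a w ≈ 0#
    t-eq w w≢v = +-inverse (trans
      (+-congˡ (+-congˡ (*-congˡ (sym (*-identityˡ _)))))
      (proj₂ (proj₂ (reduced-system 1# (λ i → - a i))) w w≢v))

    -- The eigenvector equations are proved by rearranging one side into the other plus multiples of
    -- factors that vanish: a nilsquare, or the residual of one of the three systems. This adds or
    -- removes such a multiple.
    +-null : ∀ {p} k z → p ≈ 0# → z + p * k ≈ z
    +-null k z p≈0 = trans (+-congˡ (trans (*-congʳ p≈0) (zeroˡ k))) (+-identityʳ z)

    ∙-sym : ∀ (f : Vec m) i → (N ᵀ ∙ f) i ≈ (N ∙ f) i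
    ∙-sym = ∙-congʳ (λ i j → N-sym j i)

    -- Pair the system of `x` with `ζ· t` and that of `t` with `ζ· x`. The diagonal terms agree and
    -- the `N` terms agree by symmetry; the additional summand `ζ (N t)` in the system of `t` is
    -- killed by `ζ² = 0`. What remains is the two values at `v`.
    Nζt≈g : (N ∙ ζ· t) v ≈ g
    Nζt≈g = ∙-cancelʳ (sum (λ j → (ζ· t) j * (N ∙ ζ· x) j)) _ _ (begin
      (N ∙ ζ· t) v + sum (λ j → (ζ· t) j * (N ∙ ζ· x) j)
        ≈⟨ ∑-distrib-+ {m} _ _ ⟨
      sum (λ j → N v j * (ζ· t) j + (ζ· t) j * (N ∙ ζ· x) j)
        ≈⟨ sum-cong-≋ {m} pointwise ⟩
      sum (λ j → N v j * (ζ· x) j + (ζ· x) j * (N ∙ ζ· t) j)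
        ≈⟨ ∑-distrib-+ {m} _ _ ⟩
      (N ∙ ζ· x) v + sum (λ j → (ζ· x) j * (N ∙ ζ· t) j)
        ≈⟨ +-congˡ (trans (∙-adjoint N (ζ· x) (ζ· t)) (sum-cong-≋ {m} (λ j → *-congˡ (∙-sym (ζ· x) j)))) ⟩
      (N ∙ ζ· x) v + sum (λ j → (ζ· t) j * (N ∙ ζ· x) j) ∎)
      where
      pointwise : ∀ j → N v j * (ζ· t) j + (ζ· t) j * (N ∙ ζ· x) j ≈
                        N v j * (ζ· x) j + (ζ· x) j * (N ∙ ζ· t) j
      pointwise j with j ≟ v
      -- Neither system has an equation at `v`; there both sides vanish with `x` and `t`.
      ... | yes ≡.refl = trans (vanish tv≈0) (sym (vanish xv≈0))
        where
        vanish : ∀ {x n z k} → x ≈ 0# → n * (z * x) + (z * x) * k ≈ 0#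
        vanish {x} {n} {z} {k} x≈0 = trans
          (solve 4 (λ n z x k → n :* (z :* x) :+ (z :* x) :* k := con 0 :+ x :* (n :* z :+ z :* k)) refl n z x k)
          (+-null _ 0# x≈0)
      -- The added diagonal term completes the left side to the equation of `x` times `ζ t`, and the
      -- right side to the equation of `t` times `ζ x`, up to a multiple of `ζ j * ζ j`.
      ... | no j≢v = ∙-cancelʳ (c j * x j * (ζ j * t j)) _ _ (begin
        N v j * (ζ· t) j + (ζ· t) j * X + c j * x j * (ζ· t) j
          ≈⟨ solve 6 (λ n z t X c x → n :* (z :* t) :+ (z :* t) :* X :+ c :* x :* (z :* t)
               := con 0 :+ ((c :* x :+ X) :+ n) :* (z :* t)) refl (N v j) (ζ j) (t j) X (c j) (x j) ⟩
        0# + ((c j * x j + X) + N v j) * (ζ· t) j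
          ≈⟨ +-null _ 0# (trans (+-congˡ (N-sym v j)) (x-eq j j≢v)) ⟩
        0#
          ≈⟨ +-null _ 0# (trans (+-congˡ (N-sym v j)) (t-eq j j≢v)) ⟨
        0# + ((c j * t j + (T + ζ j * U)) + N v j) * (ζ· x) j
          ≈⟨ solve 7 (λ n z t T c x U → con 0 :+ ((c :* t :+ (T :+ z :* U)) :+ n) :* (z :* x)
               := n :* (z :* x) :+ (z :* x) :* T :+ c :* x :* (z :* t) :+ (z :* z) :* (U :* x))
               refl (N v j) (ζ j) (t j) T (c j) (x j) U ⟩
        N v j * (ζ· x) j + (ζ· x) j * T + c j * x j * (ζ· t) j + (ζ j * ζ j) * (U * x j)
          ≈⟨ +-null _ _ (ζζ≈0 j) ⟩
        N v j * (ζ· x) j + (ζ· x) j * T + c j * x j * (ζ· t) j ∎)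
        where
        X T U : Carrier
        X = (N ∙ ζ· x) j
        T = (N ∙ ζ· t) j
        U = (N ∙ t) j

    q η : Vec m
    q j = e j + (ζ j * x j + s * (ζ j * y j))
    η j = e j + ((ζ j * x j + s * (ζ j * (y j + y j))) + s * t j)

    diagonal-sym : ∀ (f : Vec m) i j → diagonal f j i ≈ diagonal f i j
    diagonal-sym f i j with i ≟ j | j ≟ i
    ... | yes ≡.refl | yes _   = refl
    ... | yes i≡j    | no  j≢i = contradiction (≡.sym i≡j) j≢i
    ... | no  i≢j    | yes j≡i = contradiction (≡.sym j≡i) i≢j
    ... | no  _      | no  _   = refl

    Λᵀ-∙ : ∀ f i → (Λ D ζ N ᵀ ∙ f) i ≈ D i * f i + ζ i * (N ∙ f) i
    Λᵀ-∙ f i = begin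
      (Λ D ζ N ᵀ ∙ f) i
        ≈⟨ ∙-congʳ (λ i j → +-cong (diagonal-sym D i j) (trans (*-congʳ (N-sym j i)) (*-comm (N i j) (ζ i)))) f i ⟩
      ((λ i j → diagonal D i j + ζ i * N i j) ∙ f) i
        ≈⟨ +-∙ (diagonal D) (λ i j → ζ i * N i j) f i ⟩
      (diagonal D ∙ f) i + ((λ i j → ζ i * N i j) ∙ f) i
        ≈⟨ +-cong (diagonal-∙ D f i) (*-∙ N (ζ i) f i) ⟩
      D i * f i + ζ i * (N ∙ f) i ∎

    Λsym-∙ : ∀ f i → (Λsym D ζ N ∙ f) i ≈ D i * f i + ((N ∙ ζ· f) i + ζ i * (N ∙ f) i)
    Λsym-∙ f i = begin
      (Λsym D ζ N ∙ f) i
        ≈⟨ +-∙ (diagonal D) (λ i j → N i j * ζ j + N j i * ζ i) f i ⟩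
      (diagonal D ∙ f) i + ((λ i j → N i j * ζ j + N j i * ζ i) ∙ f) i
        ≈⟨ +-cong (diagonal-∙ D f i) (+-∙ (λ i j → N i j * ζ j) (λ i j → N j i * ζ i) f i) ⟩
      D i * f i + (((λ i j → N i j * ζ j) ∙ f) i + ((λ i j → N j i * ζ i) ∙ f) i)
        ≈⟨ +-congˡ (+-cong (sum-cong-≋ {m} (λ j → *-assoc (N i j) (ζ j) (f j)))
             (trans (∙-congʳ (λ i j → trans (*-congʳ (N-sym j i)) (*-comm (N i j) (ζ i))) f i) (*-∙ N (ζ i) f i))) ⟩
      D i * f i + ((N ∙ ζ· f) i + ζ i * (N ∙ f) i) ∎

    ζ·e : ∀ j → ζ j * e j ≈ s * e j
    ζ·e j with v ≟ j
    ... | yes ≡.refl = refl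
    ... | no  _      = trans (zeroʳ (ζ j)) (sym (zeroʳ s))

    N∙q : ∀ i → (N ∙ q) i ≈ a i + ((N ∙ ζ· x) i + s * (N ∙ ζ· y) i)
    N∙q i = begin
      (N ∙ q) i
        ≈⟨ ∙-+ N e (λ j → ζ j * x j + s * (ζ j * y j)) i ⟩
      (N ∙ e) i + (N ∙ (λ j → ζ j * x j + s * (ζ j * y j))) i
        ≈⟨ +-cong (N∙e i) (∙-+ N (ζ· x) (λ j → s * (ζ j * y j)) i) ⟩
      a i + ((N ∙ ζ· x) i + (N ∙ (λ j → s * (ζ j * y j))) i)
        ≈⟨ +-congˡ (+-congˡ (∙-* N s (ζ· y) i)) ⟩
      a i + ((N ∙ ζ· x) i + s * (N ∙ ζ· y) i) ∎

    N∙η : ∀ i → (N ∙ η) i ≈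
      a i + (((N ∙ ζ· x) i + s * ((N ∙ ζ· y) i + (N ∙ ζ· y) i)) + s * (N ∙ t) i)
    N∙η i = begin
      (N ∙ η) i
        ≈⟨ ∙-+ N e (λ j → (ζ j * x j + s * (ζ j * (y j + y j))) + s * t j) i ⟩
      (N ∙ e) i + (N ∙ (λ j → (ζ j * x j + s * (ζ j * (y j + y j))) + s * t j)) i
        ≈⟨ +-cong (N∙e i) (∙-+ N (λ j → ζ j * x j + s * (ζ j * (y j + y j))) (λ j → s * t j) i) ⟩
      a i + ((N ∙ (λ j → ζ j * x j + s * (ζ j * (y j + y j)))) i + (N ∙ (λ j → s * t j)) i)
        ≈⟨ +-congˡ (+-cong (trans (∙-+ N (ζ· x) (λ j → s * (ζ j * (y j + y j))) i)
             (+-congˡ (trans (∙-* N s (λ j → ζ j * (y j + y j)) i) (*-congˡ (trans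
               (∙-congˡ N (λ j → distribˡ (ζ j) (y j) (y j)) i) (∙-+ N (ζ· y) (ζ· y) i))))))
             (∙-* N s t i)) ⟩
      a i + (((N ∙ ζ· x) i + s * ((N ∙ ζ· y) i + (N ∙ ζ· y) i)) + s * (N ∙ t) i) ∎

    -- The part of `η` that carries a factor `ζ j` is lost on multiplication by `ζ j`, so `x` and
    -- `y` drop out.
    N∙ζη : ∀ i → (N ∙ ζ· η) i ≈ s * (a i + (N ∙ ζ· t) i)
    N∙ζη i = begin
      (N ∙ ζ· η) i
        ≈⟨ ∙-congˡ N (λ j → trans
             (solve 6 (λ z e x y s t → z :* (e :+ ((z :* x :+ s :* (z :* (y :+ y))) :+ s :* t))
                := (z :* e :+ s :* (z :* t)) :+ (z :* z) :* (x :+ s :* (y :+ y)))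
                refl (ζ j) (e j) (x j) (y j) s (t j))
             (trans (+-null _ _ (ζζ≈0 j)) (trans (+-congʳ (ζ·e j)) (sym (distribˡ s _ _))))) i ⟩
      (N ∙ (λ j → s * (e j + ζ j * t j))) i
        ≈⟨ trans (∙-* N s (λ j → e j + ζ j * t j) i) (*-congˡ (trans (∙-+ N e (ζ· t) i) (+-congʳ (N∙e i)))) ⟩
      s * (a i + (N ∙ ζ· t) i) ∎

    q-v : q v ≈ 1#
    q-v = trans (+-cong e-v (+-cong (*-congˡ xv≈0) (*-congˡ (*-congˡ yv≈0))))
      (solve 1 (λ s → con 1 :+ (s :* con 0 :+ s :* (s :* con 0)) := con 1) refl s)

    η-v : η v ≈ 1#
    η-v = trans
      (+-cong e-v (+-cong (+-cong (*-congˡ xv≈0) (*-congˡ (*-congˡ (+-cong yv≈0 yv≈0)))) (*-congˡ tv≈0)))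
      (solve 1 (λ s → con 1 :+ ((s :* con 0 :+ s :* (s :* (con 0 :+ con 0))) :+ s :* con 0) := con 1) refl s)

    q-≢ : ∀ {w} → w ≢ v → q w ≈ ζ w * x w + s * (ζ w * y w)
    q-≢ w≢v = trans (+-congʳ (e-≢ w≢v)) (+-identityˡ _)

    η-≢ : ∀ {w} → w ≢ v → η w ≈ (ζ w * x w + s * (ζ w * (y w + y w))) + s * t w
    η-≢ w≢v = trans (+-congʳ (e-≢ w≢v)) (+-identityˡ _)

    Λ-left-eigen : ∀ i → (Λ D ζ N ᵀ ∙ q) i ≈ (d + s * g) * q i
    Λ-left-eigen i = trans (trans (Λᵀ-∙ q i) (+-congˡ (*-congˡ (N∙q i)))) (eigen i)
      where
      eigen : ∀ i → D i * q i + ζ i * (a i + ((N ∙ ζ· x) i + s * (N ∙ ζ· y) i)) ≈ (d + s * g) * q i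
      eigen i with i ≟ v
      ... | yes ≡.refl = begin
        (d + c v) * q v + s * (a v + (g + s * Y))
          ≈⟨ +-cong (*-cong (+-congˡ cv≈0) q-v) (*-congˡ (+-congʳ Nvv≈0)) ⟩
        -- In row `v` the contribution of `y` carries `s * s`; the eigenvalue therefore depends on
        -- `x` alone, through `g`.
        (d + 0#) * 1# + s * (0# + (g + s * Y))
          ≈⟨ solve 4 (λ d s g Y → (d :+ con 0) :* con 1 :+ s :* (con 0 :+ (g :+ s :* Y))
               := (d :+ s :* g) :* con 1 :+ (s :* s) :* Y) refl d s g Y ⟩
        (d + s * g) * 1# + (s * s) * Y
          ≈⟨ trans (+-null Y _ (ζζ≈0 v)) (*-congˡ (sym q-v)) ⟩
        (d + s * g) * q v ∎
        where
        Y : Carrier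
        Y = (N ∙ ζ· y) v
      ... | no i≢v = begin
        (d + c i) * q i + ζ i * (a i + (X + s * Y))
          ≈⟨ +-congʳ (*-congˡ (q-≢ i≢v)) ⟩
        (d + c i) * (ζ i * x i + s * (ζ i * y i)) + ζ i * (a i + (X + s * Y))
          -- Sorted by powers of `s`: the residual of `x` appears with factor `ζ i`, the left side
          -- of the equation of `y` with factor `s * ζ i`.
          ≈⟨ solve 9 (λ d c z x s y a X Y → (d :+ c) :* (z :* x :+ s :* (z :* y)) :+ z :* (a :+ (X :+ s :* Y))
               := (d :* (z :* x :+ s :* (z :* y)) :+ s :* z :* (c :* y :+ Y)) :+ ((c :* x :+ X) :+ a) :* z)
               refl d (c i) (ζ i) (x i) s (y i) (a i) X Y ⟩
        (d * (ζ i * x i + s * (ζ i * y i)) + s * ζ i * (c i * y i + Y)) + ((c i * x i + X) + a i) * ζ i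
          ≈⟨ trans (+-null _ _ (x-eq i i≢v)) (+-congˡ (*-congˡ (y-eq i i≢v))) ⟩
        d * (ζ i * x i + s * (ζ i * y i)) + s * ζ i * (g * x i)
          -- The vanishing term with `s * s` is inserted so that `d + s * g` factors out.
          ≈⟨ +-null (g * (ζ i * y i)) _ (ζζ≈0 v) ⟨
        (d * (ζ i * x i + s * (ζ i * y i)) + s * ζ i * (g * x i)) + (s * s) * (g * (ζ i * y i))
          ≈⟨ solve 6 (λ d z x s y g →
               (d :* (z :* x :+ s :* (z :* y)) :+ s :* z :* (g :* x)) :+ (s :* s) :* (g :* (z :* y))
               := (d :+ s :* g) :* (z :* x :+ s :* (z :* y))) refl d (ζ i) (x i) s (y i) g ⟩
        (d + s * g) * (ζ i * x i + s * (ζ i * y i))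
          ≈⟨ *-congˡ (q-≢ i≢v) ⟨
        (d + s * g) * q i ∎
        where
        X Y : Carrier
        X = (N ∙ ζ· x) i
        Y = (N ∙ ζ· y) i

    Λsym-eigen : ∀ i → (Λsym D ζ N ∙ η) i ≈ (d + (s * g + s * g)) * η i
    Λsym-eigen i = trans
      (trans (Λsym-∙ η i) (+-congˡ (+-cong (N∙ζη i) (*-congˡ (N∙η i))))) (eigen i)
      where
      eigen : ∀ i → D i * η i + (s * (a i + (N ∙ ζ· t) i) + ζ i *
        (a i + (((N ∙ ζ· x) i + s * ((N ∙ ζ· y) i + (N ∙ ζ· y) i)) + s * (N ∙ t) i))) ≈
        (d + (s * g + s * g)) * η i
      eigen i with i ≟ v
      ... | yes ≡.refl = begin
        (d + c v) * η v + (s * (a v + (N ∙ ζ· t) v) + s * (a v + ((g + s * (Y + Y)) + s * U)))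
          ≈⟨ +-cong (*-cong (+-congˡ cv≈0) η-v)
               (+-cong (*-congˡ (+-cong Nvv≈0 Nζt≈g)) (*-congˡ (+-congʳ Nvv≈0))) ⟩
        (d + 0#) * 1# + (s * (0# + g) + s * (0# + ((g + s * (Y + Y)) + s * U)))
          ≈⟨ solve 5 (λ d s g Y U →
               (d :+ con 0) :* con 1 :+ (s :* (con 0 :+ g) :+ s :* (con 0 :+ ((g :+ s :* (Y :+ Y)) :+ s :* U)))
               := (d :+ (s :* g :+ s :* g)) :* con 1 :+ (s :* s) :* ((Y :+ Y) :+ U)) refl d s g Y U ⟩
        (d + (s * g + s * g)) * 1# + (s * s) * ((Y + Y) + U)
          ≈⟨ trans (+-null _ _ (ζζ≈0 v)) (*-congˡ (sym η-v)) ⟩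
        (d + (s * g + s * g)) * η v ∎
        where
        Y U : Carrier
        Y = (N ∙ ζ· y) v
        U = (N ∙ t) v
      ... | no i≢v = begin
        (d + c i) * η i + (s * (a i + T) + ζ i * (a i + ((X + s * (Y + Y)) + s * U)))
          ≈⟨ +-congʳ (*-congˡ (η-≢ i≢v)) ⟩
        (d + c i) * ((ζ i * x i + s * (ζ i * (y i + y i))) + s * t i) +
          (s * (a i + T) + ζ i * (a i + ((X + s * (Y + Y)) + s * U)))
          -- Three kinds of terms separate: factor `ζ i` gives the system of `x`, `s * ζ i` twice
          -- the system of `y`, and `s` the system of `t`. The product `s * ζ i * U` is counted with
          -- `t`, which is why only that system has the summand `ζ (N t)`.
          ≈⟨ solve 12 (λ d c z x s y t a X Y T U →
               (d :+ c) :* ((z :* x :+ s :* (z :* (y :+ y))) :+ s :* t) :+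
                 (s :* (a :+ T) :+ z :* (a :+ ((X :+ s :* (Y :+ Y)) :+ s :* U)))
               := ((d :* ((z :* x :+ s :* (z :* (y :+ y))) :+ s :* t) :+ (s :* z :+ s :* z) :* (c :* y :+ Y))
                 :+ ((c :* x :+ X) :+ a) :* z) :+ ((c :* t :+ (T :+ z :* U)) :+ a) :* s)
               refl d (c i) (ζ i) (x i) s (y i) (t i) (a i) X Y T U ⟩
        ((d * ((ζ i * x i + s * (ζ i * (y i + y i))) + s * t i) + (s * ζ i + s * ζ i) * (c i * y i + Y))
          + ((c i * x i + X) + a i) * ζ i) + ((c i * t i + (T + ζ i * U)) + a i) * s
          ≈⟨ trans (+-null _ _ (t-eq i i≢v)) (trans (+-null _ _ (x-eq i i≢v)) (+-congˡ (*-congˡ (y-eq i i≢v)))) ⟩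
        d * ((ζ i * x i + s * (ζ i * (y i + y i))) + s * t i) + (s * ζ i + s * ζ i) * (g * x i)
          ≈⟨ +-null _ _ (ζζ≈0 v) ⟨
        (d * ((ζ i * x i + s * (ζ i * (y i + y i))) + s * t i) + (s * ζ i + s * ζ i) * (g * x i))
          + (s * s) * ((g + g) * (ζ i * (y i + y i)) + (g + g) * t i)
          ≈⟨ solve 7 (λ d z x s y t g →
               (d :* ((z :* x :+ s :* (z :* (y :+ y))) :+ s :* t) :+ (s :* z :+ s :* z) :* (g :* x))
               :+ (s :* s) :* ((g :+ g) :* (z :* (y :+ y)) :+ (g :+ g) :* t)
               := (d :+ (s :* g :+ s :* g)) :* ((z :* x :+ s :* (z :* (y :+ y))) :+ s :* t))
               refl d (ζ i) (x i) s (y i) (t i) g ⟩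
        (d + (s * g + s * g)) * ((ζ i * x i + s * (ζ i * (y i + y i))) + s * t i)
          ≈⟨ *-congˡ (η-≢ i≢v) ⟨
        (d + (s * g + s * g)) * η i ∎
        where
        X Y T U : Carrier
        X = (N ∙ ζ· x) i
        Y = (N ∙ ζ· y) i
        T = (N ∙ ζ· t) i
        U = (N ∙ t) i

    -- By symmetry of `Λsym`, the vector `η` serves both for the existence of the eigenvalue and, as
    -- a left eigenvector, for its uniqueness.
    Λsym-left-eigen : ∀ i → (Λsym D ζ N ᵀ ∙ η) i ≈ (d + (s * g + s * g)) * η i
    Λsym-left-eigen i = trans
      (∙-congʳ (λ i j → +-cong (diagonal-sym D i j) (+-comm (N j i * ζ i) (N i j * ζ j))) η i) (Λsym-eigen i)

open import Defs

-- Real and complex numbers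

-- Limits are handled on bare rational sequences, so that each law of the reals reduces to a
-- termwise ring identity transported by `Null-resp`.
record Null (s : ℕ → ℚ) : Set where
  constructor mkNull
  field
    close : ∀ ε → 0ℚ ℚ.< ε → ∃[ N ] (∀ n → N ℕ.≤ n → ∣ s n ∣ℚ ℚ.< ε)

open Null

½*-pos : ∀ {ε} → 0ℚ ℚ.< ε → 0ℚ ℚ.< ½ ℚ.* ε
½*-pos {ε} ε>0 = subst (ℚ._< ½ ℚ.* ε) (ℚₚ.*-zeroʳ ½) (ℚₚ.*-monoʳ-<-pos ½ ε>0)

½*+½* : ∀ ε → ½ ℚ.* ε ℚ.+ ½ ℚ.* ε ≡ ε
½*+½* ε = ≡.trans (≡.sym (ℚₚ.*-distribʳ-+ ε ½ ½)) (ℚₚ.*-identityˡ ε)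

divide : ∀ b ε → 0ℚ ℚ.< b → 0ℚ ℚ.< ε → ∃[ δ ] (0ℚ ℚ.< δ × b ℚ.* δ ≡ ε)
divide b ε b>0 ε>0 = 1/ b ℚ.* ε , ℚₚ.positive⁻¹ (1/ b ℚ.* ε) {{ℚₚ.pos*pos⇒pos (1/ b) ε}} ,
  ≡.trans (≡.sym (ℚₚ.*-assoc b (1/ b) ε))
    (≡.trans (cong (ℚ._* ε) (ℚₚ.*-inverseʳ b)) (ℚₚ.*-identityˡ ε))
  where
  instance
    _ = ℚ.positive b>0
    _ = ℚ.positive ε>0
    _ = ℚₚ.pos⇒nonZero b
    _ = ℚₚ.1/pos⇒pos b

∣∣-mono-*-< : ∀ a b {B δ} → 0ℚ ℚ.< B → ∣ a ∣ℚ ℚ.≤ B → ∣ b ∣ℚ ℚ.< δ → ∣ a ℚ.* b ∣ℚ ℚ.< B ℚ.* δ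
∣∣-mono-*-< a b {B} {δ} B>0 a≤B b<δ = begin-strict
  ∣ a ℚ.* b ∣ℚ       ≡⟨ ℚₚ.∣p*q∣≡∣p∣*∣q∣ a b ⟩
  ∣ a ∣ℚ ℚ.* ∣ b ∣ℚ  ≤⟨ ℚₚ.*-monoʳ-≤-nonNeg ∣ b ∣ℚ {{ℚ.nonNegative (ℚₚ.0≤∣p∣ b)}} a≤B ⟩
  B ℚ.* ∣ b ∣ℚ       <⟨ ℚₚ.*-monoʳ-<-pos B {{ℚ.positive B>0}} b<δ ⟩
  B ℚ.* δ            ∎
  where open ℚₚ.≤-Reasoning

∣p∣≤∣q∣+∣p-q∣ : ∀ p q → ∣ p ∣ℚ ℚ.≤ ∣ q ∣ℚ ℚ.+ ∣ p ℚ.- q ∣ℚ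
∣p∣≤∣q∣+∣p-q∣ p q = subst (λ r → ∣ r ∣ℚ ℚ.≤ ∣ q ∣ℚ ℚ.+ ∣ p ℚ.- q ∣ℚ)
  (solve 2 (λ p q → q :+ (p :- q) := p) ≡.refl p q) (ℚₚ.∣p+q∣≤∣p∣+∣q∣ q (p ℚ.- q))
  where open +-*-Solver

cauchy⇒bounded : ∀ {s : ℕ → ℚ} → IsCauchy s →
  ∃[ B ] (0ℚ ℚ.< B × ∃[ N ] (∀ n → N ℕ.≤ n → ∣ s n ∣ℚ ℚ.≤ B))
cauchy⇒bounded {s} c =
  ∣ s N ∣ℚ ℚ.+ 1ℚ , ℚₚ.+-mono-≤-< (ℚₚ.0≤∣p∣ (s N)) (ℚₚ.positive⁻¹ 1ℚ) , N ,
  λ n N≤n → ℚₚ.≤-trans (∣p∣≤∣q∣+∣p-q∣ (s n) (s N))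
    (ℚₚ.+-monoʳ-≤ ∣ s N ∣ℚ (ℚₚ.<⇒≤ (proj₂ (c 1ℚ (ℚₚ.positive⁻¹ 1ℚ)) n N N≤n ℕₚ.≤-refl)))
  where N = proj₁ (c 1ℚ (ℚₚ.positive⁻¹ 1ℚ))

Null-resp : ∀ {s t : ℕ → ℚ} → (∀ n → s n ≡ t n) → Null s → Null t
Null-resp eq h = mkNull λ ε ε>0 → proj₁ (close h ε ε>0) , λ n N≤n →
  subst (λ r → ∣ r ∣ℚ ℚ.< ε) (eq n) (proj₂ (close h ε ε>0) n N≤n)

Null-0 : Null (λ _ → 0ℚ)
Null-0 = mkNull λ ε ε>0 → 0 , λ _ _ → ε>0

Null-neg : ∀ {s : ℕ → ℚ} → Null s → Null (λ n → ℚ.- s n)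
Null-neg {s} h = mkNull λ ε ε>0 → proj₁ (close h ε ε>0) , λ n N≤n →
  subst (ℚ._< ε) (≡.sym (ℚₚ.∣-p∣≡∣p∣ (s n))) (proj₂ (close h ε ε>0) n N≤n)

Null-+ : ∀ {s t : ℕ → ℚ} → Null s → Null t → Null (λ n → s n ℚ.+ t n)
Null-+ {s} {t} hs ht = mkNull λ ε ε>0 →
  let M , s<½ε = close hs (½ ℚ.* ε) (½*-pos ε>0)
      N , t<½ε = close ht (½ ℚ.* ε) (½*-pos ε>0)
  in M ⊔ N , λ n n≥ → ℚₚ.≤-<-trans (ℚₚ.∣p+q∣≤∣p∣+∣q∣ (s n) (t n))
       (subst (∣ s n ∣ℚ ℚ.+ ∣ t n ∣ℚ ℚ.<_) (½*+½* ε)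
         (ℚₚ.+-mono-< (s<½ε n (ℕₚ.m⊔n≤o⇒m≤o M N n≥)) (t<½ε n (ℕₚ.m⊔n≤o⇒n≤o M N n≥))))

Null-* : ∀ {s t : ℕ → ℚ} → IsCauchy s → Null t → Null (λ n → s n ℚ.* t n)
Null-* {s} {t} cs ht = mkNull λ ε ε>0 →
  let B , B>0 , M , s≤B = cauchy⇒bounded cs
      δ , δ>0 , Bδ≡ε    = divide B ε B>0 ε>0
      N , t<δ           = close ht δ δ>0
  in M ⊔ N , λ n n≥ → subst (∣ s n ℚ.* t n ∣ℚ ℚ.<_) Bδ≡ε
       (∣∣-mono-*-< (s n) (t n) B>0 (s≤B n (ℕₚ.m⊔n≤o⇒m≤o M N n≥)) (t<δ n (ℕₚ.m⊔n≤o⇒n≤o M N n≥)))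

-- Eventually `∣ s n ∣ q ≤ ∣ s n t n ∣`, so the bound `ε q` on the product yields `ε` for `s`.
bounded-away-*⇒Null : ∀ {s t : ℕ → ℚ} {q N} → 0ℚ ℚ.< q → (∀ n → N ℕ.≤ n → q ℚ.≤ ∣ t n ∣ℚ) →
  Null (λ n → s n ℚ.* t n) → Null s
bounded-away-*⇒Null {s} {t} {q} {N} q>0 q≤t h = mkNull λ ε ε>0 →
  let M , st<εq = close h (ε ℚ.* q) (εq>0 ε>0)
  in N ⊔ M , λ n n≥ →
  ℚₚ.*-cancelʳ-<-nonNeg q {{ℚ.nonNegative (ℚₚ.<⇒≤ q>0)}} (begin-strict
    ∣ s n ∣ℚ ℚ.* q         ≤⟨ ℚₚ.*-monoˡ-≤-nonNeg ∣ s n ∣ℚ {{ℚ.nonNegative (ℚₚ.0≤∣p∣ (s n))}}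
                                (q≤t n (ℕₚ.m⊔n≤o⇒m≤o N M n≥)) ⟩
    ∣ s n ∣ℚ ℚ.* ∣ t n ∣ℚ  ≡⟨ ℚₚ.∣p*q∣≡∣p∣*∣q∣ (s n) (t n) ⟨
    ∣ s n ℚ.* t n ∣ℚ       <⟨ st<εq n (ℕₚ.m⊔n≤o⇒n≤o N M n≥) ⟩
    ε ℚ.* q                ∎)
  where
  open ℚₚ.≤-Reasoning
  εq>0 : ∀ {ε} → 0ℚ ℚ.< ε → 0ℚ ℚ.< ε ℚ.* q
  εq>0 {ε} ε>0 = ℚₚ.positive⁻¹ (ε ℚ.* q) {{ℚₚ.pos*pos⇒pos ε {{ℚ.positive ε>0}} q {{ℚ.positive q>0}}}}

-- Comparing one far-out term of t with ε/2 decides whether t is eventually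
-- below ε or bounded away from 0, so no appeal to excluded middle is needed.
Null-*-cancel : ∀ {s t : ℕ → ℚ} → IsCauchy t → Null (λ n → s n ℚ.* t n) → ¬ Null s → Null t
Null-*-cancel {s} {t} ct st≈0 s≉0 = mkNull bound
  where
  open ℚₚ.≤-Reasoning
  dichotomy : ∀ {q N} → 0ℚ ℚ.< q →
    (∀ n → N ℕ.≤ n → ∣ t N ∣ℚ ℚ.≤ q ℚ.+ q → ∣ t n ∣ℚ ℚ.< (q ℚ.+ q) ℚ.+ (q ℚ.+ q)) →
    (∀ n → N ℕ.≤ n → q ℚ.+ q ℚ.≤ ∣ t N ∣ℚ → q ℚ.≤ ∣ t n ∣ℚ) →
    ∀ n → N ℕ.≤ n → ∣ t n ∣ℚ ℚ.< (q ℚ.+ q) ℚ.+ (q ℚ.+ q)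
  dichotomy {q} {N} q>0 small large n N≤n = [ small n N≤n , (λ ≥ → contradiction
    (bounded-away-*⇒Null {s} {t} q>0 (λ k N≤k → large k N≤k ≥) st≈0) s≉0) ]′ (ℚₚ.≤-total ∣ t N ∣ℚ (q ℚ.+ q))
  bound : ∀ ε → 0ℚ ℚ.< ε → ∃[ N ] (∀ n → N ℕ.≤ n → ∣ t n ∣ℚ ℚ.< ε)
  bound ε ε>0 = N , λ n N≤n → subst (∣ t n ∣ℚ ℚ.<_) 4q≡ε (dichotomy q>0 small large n N≤n)
    where
    -- A quarter of `ε`: terms beyond `N` differ by less than `q`, so the threshold `2q` at `N`
    -- leaves more than enough room below `4q` on one side and at least `q` on the other.
    q = ½ ℚ.* (½ ℚ.* ε)
    4q≡ε : (q ℚ.+ q) ℚ.+ (q ℚ.+ q) ≡ ε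
    4q≡ε = ≡.trans (cong₂ ℚ._+_ (½*+½* (½ ℚ.* ε)) (½*+½* (½ ℚ.* ε))) (½*+½* ε)
    q>0 : 0ℚ ℚ.< q
    q>0 = ½*-pos (½*-pos ε>0)
    q<q+q : q ℚ.< q ℚ.+ q
    q<q+q = subst (ℚ._< q ℚ.+ q) (ℚₚ.+-identityʳ q) (ℚₚ.+-monoʳ-< q q>0)
    N = proj₁ (ct q q>0)
    near : ∀ m n → N ℕ.≤ m → N ℕ.≤ n → ∣ t m ℚ.- t n ∣ℚ ℚ.< q
    near = proj₂ (ct q q>0)
    small : ∀ n → N ℕ.≤ n → ∣ t N ∣ℚ ℚ.≤ q ℚ.+ q → ∣ t n ∣ℚ ℚ.< (q ℚ.+ q) ℚ.+ (q ℚ.+ q)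
    small n N≤n tN≤2q = ℚₚ.≤-<-trans (∣p∣≤∣q∣+∣p-q∣ (t n) (t N))
      (ℚₚ.+-mono-≤-< tN≤2q (ℚₚ.<-trans (near n N N≤n ℕₚ.≤-refl) q<q+q))
    large : ∀ n → N ℕ.≤ n → q ℚ.+ q ℚ.≤ ∣ t N ∣ℚ → q ℚ.≤ ∣ t n ∣ℚ
    large n N≤n 2q≤tN = ℚₚ.≮⇒≥ λ tn<q → ℚₚ.<-irrefl ≡.refl (begin-strict
      ∣ t N ∣ℚ                          ≤⟨ ∣p∣≤∣q∣+∣p-q∣ (t N) (t n) ⟩
      ∣ t n ∣ℚ ℚ.+ ∣ t N ℚ.- t n ∣ℚ     <⟨ ℚₚ.+-mono-< tn<q (near N n ℕₚ.≤-refl N≤n) ⟩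
      q ℚ.+ q                           ≤⟨ 2q≤tN ⟩
      ∣ t N ∣ℚ                          ∎)

∣p∣*∣p∣≡p*p : ∀ p → ∣ p ∣ℚ ℚ.* ∣ p ∣ℚ ≡ p ℚ.* p
∣p∣*∣p∣≡p*p p with ℚₚ.∣p∣≡p∨∣p∣≡-p p
... | inj₁ eq = cong₂ ℚ._*_ eq eq
... | inj₂ eq = ≡.trans (cong₂ ℚ._*_ eq eq)
  (solve 1 (λ p → (:- p) :* (:- p) := p :* p) ≡.refl p)
  where open +-*-Solver

-- If `ε ≤ ∣ s n ∣`, the sum of squares is at least `ε * ε`; comparing squares avoids square roots.
Null-sum-of-squares : ∀ {s t : ℕ → ℚ} → Null (λ n → s n ℚ.* s n ℚ.+ t n ℚ.* t n) → Null s
Null-sum-of-squares {s} {t} h = mkNull bound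
  where
  open ℚₚ.≤-Reasoning
  0≤p*p : ∀ p → 0ℚ ℚ.≤ p ℚ.* p
  0≤p*p p = subst (0ℚ ℚ.≤_) (∣p∣*∣p∣≡p*p p) (ℚₚ.nonNegative⁻¹ (∣ p ∣ℚ ℚ.* ∣ p ∣ℚ)
    {{ℚₚ.nonNeg*nonNeg⇒nonNeg ∣ p ∣ℚ {{∣p∣≥0}} ∣ p ∣ℚ {{∣p∣≥0}}}})
    where ∣p∣≥0 = ℚ.nonNegative (ℚₚ.0≤∣p∣ p)
  p≤∣p∣ : ∀ p → p ℚ.≤ ∣ p ∣ℚ
  p≤∣p∣ p = [ (λ 0≤p → ℚₚ.≤-reflexive (≡.sym (ℚₚ.0≤p⇒∣p∣≡p 0≤p)))
            , (λ p≤0 → ℚₚ.≤-trans p≤0 (ℚₚ.0≤∣p∣ p)) ]′ (ℚₚ.≤-total 0ℚ p)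
  bound : ∀ ε → 0ℚ ℚ.< ε → ∃[ N ] (∀ n → N ℕ.≤ n → ∣ s n ∣ℚ ℚ.< ε)
  bound ε ε>0 =
    let N , ss+tt<εε = close h (ε ℚ.* ε) (ℚₚ.positive⁻¹ (ε ℚ.* ε) {{ℚₚ.pos*pos⇒pos ε ε}})
    in N , λ n N≤n → ℚₚ.≰⇒> λ ε≤sn → ℚₚ.<-irrefl ≡.refl (begin-strict
    ε ℚ.* ε                        ≤⟨ ℚₚ.*-monoʳ-≤-nonNeg ε ε≤sn ⟩
    ∣ s n ∣ℚ ℚ.* ε                 ≤⟨ ℚₚ.*-monoˡ-≤-nonNeg ∣ s n ∣ℚ {{ℚ.nonNegative (ℚₚ.0≤∣p∣ (s n))}} ε≤sn ⟩
    ∣ s n ∣ℚ ℚ.* ∣ s n ∣ℚ          ≡⟨ ∣p∣*∣p∣≡p*p (s n) ⟩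
    s n ℚ.* s n                    ≡⟨ ℚₚ.+-identityʳ (s n ℚ.* s n) ⟨
    s n ℚ.* s n ℚ.+ 0ℚ             ≤⟨ ℚₚ.+-monoʳ-≤ (s n ℚ.* s n) (0≤p*p (t n)) ⟩
    s n ℚ.* s n ℚ.+ t n ℚ.* t n    ≤⟨ p≤∣p∣ (s n ℚ.* s n ℚ.+ t n ℚ.* t n) ⟩
    ∣ s n ℚ.* s n ℚ.+ t n ℚ.* t n ∣ℚ  <⟨ ss+tt<εε n N≤n ⟩
    ε ℚ.* ε                        ∎)
    where
    instance
      _ = ℚ.positive ε>0
      _ = ℚ.nonNegative (ℚₚ.<⇒≤ ε>0)

≈ℝ⇒Null : ∀ {x y} → x ≈ℝ y → Null (λ n → seq x n ℚ.- seq y n)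
≈ℝ⇒Null (mk≈ℝ h) = mkNull h

Null⇒≈ℝ : ∀ {x y} → Null (λ n → seq x n ℚ.- seq y n) → x ≈ℝ y
Null⇒≈ℝ (mkNull h) = mk≈ℝ h

0ℝ : ℝ
0ℝ = ℚ→ℝ 0ℚ

≈ℝ-pointwise : ∀ {x y} → (∀ n → seq x n ≡ seq y n) → x ≈ℝ y
≈ℝ-pointwise {x} {y} eq = Null⇒≈ℝ (Null-resp
  (λ n → ≡.trans (≡.sym (ℚₚ.+-inverseʳ (seq y n))) (cong (ℚ._- seq y n) (≡.sym (eq n)))) Null-0)

≈0⇒Null : ∀ {x} → x ≈ℝ 0ℝ → Null (seq x)
≈0⇒Null {x} h = Null-resp (λ n → ℚₚ.+-identityʳ (seq x n)) (≈ℝ⇒Null h)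

Null⇒≈0 : ∀ {x} → Null (seq x) → x ≈ℝ 0ℝ
Null⇒≈0 {x} h = Null⇒≈ℝ (Null-resp (λ n → ≡.sym (ℚₚ.+-identityʳ (seq x n))) h)

≈ℝ-refl : ∀ {x} → x ≈ℝ x
≈ℝ-refl = ≈ℝ-pointwise (λ _ → ≡.refl)

≈ℝ-sym : ∀ {x y} → x ≈ℝ y → y ≈ℝ x
≈ℝ-sym {x} {y} h = Null⇒≈ℝ (Null-resp (λ n → eq (seq x n) (seq y n)) (Null-neg (≈ℝ⇒Null h)))
  where
  open +-*-Solver
  eq = solve 2 (λ x y → :- (x :- y) := y :- x) ≡.refl

≈ℝ-trans : ∀ {x y z} → x ≈ℝ y → y ≈ℝ z → x ≈ℝ z
≈ℝ-trans {x} {y} {z} h k =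
  Null⇒≈ℝ (Null-resp (λ n → eq (seq x n) (seq y n) (seq z n)) (Null-+ (≈ℝ⇒Null h) (≈ℝ⇒Null k)))
  where
  open +-*-Solver
  eq = solve 3 (λ x y z → (x :- y) :+ (y :- z) := x :- z) ≡.refl

+ℝ-cong : ∀ {x x′ y y′} → x ≈ℝ x′ → y ≈ℝ y′ → x +ℝ y ≈ℝ x′ +ℝ y′
+ℝ-cong {x} {x′} {y} {y′} h k =
  Null⇒≈ℝ (Null-resp (λ n → eq (seq x n) (seq x′ n) (seq y n) (seq y′ n)) (Null-+ (≈ℝ⇒Null h) (≈ℝ⇒Null k)))
  where
  open +-*-Solver
  eq = solve 4 (λ x x′ y y′ → (x :- x′) :+ (y :- y′) := (x :+ y) :- (x′ :+ y′)) ≡.refl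

-ℝ-cong : ∀ {x y} → x ≈ℝ y → -ℝ x ≈ℝ -ℝ y
-ℝ-cong {x} {y} h = Null⇒≈ℝ (Null-resp (λ n → eq (seq x n) (seq y n)) (Null-neg (≈ℝ⇒Null h)))
  where
  open +-*-Solver
  eq = solve 2 (λ x y → :- (x :- y) := (:- x) :- (:- y)) ≡.refl

*ℝ-cong : ∀ {x x′ y y′} → x ≈ℝ x′ → y ≈ℝ y′ → x *ℝ y ≈ℝ x′ *ℝ y′
*ℝ-cong {x} {x′} {y} {y′} h k =
  Null⇒≈ℝ (Null-resp (λ n → eq (seq x n) (seq x′ n) (seq y n) (seq y′ n))
    (Null-+ (Null-* {seq x} (cauchy x) (≈ℝ⇒Null k)) (Null-* {seq y′} (cauchy y′) (≈ℝ⇒Null h))))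
  where
  open +-*-Solver
  eq = solve 4 (λ x x′ y y′ → x :* (y :- y′) :+ y′ :* (x :- x′) := x :* y :- x′ :* y′) ≡.refl

*ℝ-cancel-≉0 : ∀ {x y} → x *ℝ y ≈ℝ 0ℝ → ¬ x ≈ℝ 0ℝ → y ≈ℝ 0ℝ
*ℝ-cancel-≉0 {x} {y} xy≈0 x≉0 = Null⇒≈0 (Null-*-cancel {seq x} (cauchy y) (≈0⇒Null xy≈0) (λ h → x≉0 (Null⇒≈0 h)))

-- The complex numbers as a commutative ring with cancellation

-- Unlike the pair _≈ℂ_, a record type determines z and w, so they can be
-- inferred from proofs.
infix 4 _≋_
record _≋_ (z w : ℂ) : Set where
  constructor mk≋
  field
    pair : z ≈ℂ w

≋-pointwise : ∀ {z w} → (∀ n → seq (re z) n ≡ seq (re w) n) →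
  (∀ n → seq (im z) n ≡ seq (im w) n) → z ≋ w
≋-pointwise p q = mk≋ (≈ℝ-pointwise p , ≈ℝ-pointwise q)

≋-isEquivalence : IsEquivalence _≋_
≋-isEquivalence = record
  { refl  = mk≋ (≈ℝ-refl , ≈ℝ-refl)
  ; sym   = λ (mk≋ (p , q)) → mk≋ (≈ℝ-sym p , ≈ℝ-sym q)
  ; trans = λ (mk≋ (p , q)) (mk≋ (p′ , q′)) → mk≋ (≈ℝ-trans p p′ , ≈ℝ-trans q q′)
  }

≋-setoid : Setoid _ _
≋-setoid = record { isEquivalence = ≋-isEquivalence }

conjℂ-cong : ∀ {z w} → z ≋ w → conjℂ z ≋ conjℂ w
conjℂ-cong {z} {w} (mk≋ (p , q)) = mk≋ (p , -ℝ-cong {im z} {im w} q)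

-- Conversion checking unfolds the operations on ℂ down to their proofs of the
-- Cauchy property, which is prohibitively slow; hence opaque copies.
infixl 6 _⊕_
infixl 7 _⊗_
infix  8 ⊖_

opaque
  _⊕_ _⊗_ : ℂ → ℂ → ℂ
  z ⊕ w = z +ℂ w
  z ⊗ w = z *ℂ w

  ⊖_ : ℂ → ℂ
  ⊖ z = -ℂ z

  ⊕-def : ∀ z w → z +ℂ w ≡ z ⊕ w
  ⊕-def z w = ≡.refl

  ⊗-def : ∀ z w → z *ℂ w ≡ z ⊗ w
  ⊗-def z w = ≡.refl

  ⊖-def : ∀ z → -ℂ z ≡ ⊖ z
  ⊖-def z = ≡.refl

  ⊕-cong : ∀ {z z′ w w′} → z ≋ z′ → w ≋ w′ → z ⊕ w ≋ z′ ⊕ w′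
  ⊕-cong {z} {z′} {w} {w′} (mk≋ (p , q)) (mk≋ (p′ , q′)) = mk≋
    ( +ℝ-cong {re z} {re z′} {re w} {re w′} p p′
    , +ℝ-cong {im z} {im z′} {im w} {im w′} q q′ )

  ⊖-cong : ∀ {z w} → z ≋ w → ⊖ z ≋ ⊖ w
  ⊖-cong {z} {w} (mk≋ (p , q)) = mk≋ (-ℝ-cong {re z} {re w} p , -ℝ-cong {im z} {im w} q)

  ⊗-cong : ∀ {z z′ w w′} → z ≋ z′ → w ≋ w′ → z ⊗ w ≋ z′ ⊗ w′
  ⊗-cong {z} {z′} {w} {w′} (mk≋ (p , q)) (mk≋ (p′ , q′)) = mk≋
    ( +ℝ-cong {re z *ℝ re w} {re z′ *ℝ re w′} { -ℝ (im z *ℝ im w)} { -ℝ (im z′ *ℝ im w′)}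
        (*ℝ-cong {re z} {re z′} {re w} {re w′} p p′)
        (-ℝ-cong {im z *ℝ im w} {im z′ *ℝ im w′} (*ℝ-cong {im z} {im z′} {im w} {im w′} q q′))
    , +ℝ-cong {re z *ℝ im w} {re z′ *ℝ im w′} {im z *ℝ re w} {im z′ *ℝ re w′}
        (*ℝ-cong {re z} {re z′} {im w} {im w′} p q′)
        (*ℝ-cong {im z} {im z′} {re w} {re w′} q p′) )

  ⊕-assoc : ∀ x y z → (x ⊕ y) ⊕ z ≋ x ⊕ (y ⊕ z)
  ⊕-assoc x y z = ≋-pointwise
    (λ n → solve 6 (λ a b c d e f → (a :+ c) :+ e := a :+ (c :+ e)) ≡.refl
      (seq (re x) n) (seq (im x) n) (seq (re y) n) (seq (im y) n) (seq (re z) n) (seq (im z) n))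
    (λ n → solve 6 (λ a b c d e f → (b :+ d) :+ f := b :+ (d :+ f)) ≡.refl
      (seq (re x) n) (seq (im x) n) (seq (re y) n) (seq (im y) n) (seq (re z) n) (seq (im z) n))
    where open +-*-Solver

  ⊕-comm : ∀ x y → x ⊕ y ≋ y ⊕ x
  ⊕-comm x y = ≋-pointwise
    (λ n → solve 4 (λ a b c d → a :+ c := c :+ a) ≡.refl
      (seq (re x) n) (seq (im x) n) (seq (re y) n) (seq (im y) n))
    (λ n → solve 4 (λ a b c d → b :+ d := d :+ b) ≡.refl
      (seq (re x) n) (seq (im x) n) (seq (re y) n) (seq (im y) n))
    where open +-*-Solver

  ⊕-identityˡ : ∀ x → 0ℂ ⊕ x ≋ x
  ⊕-identityˡ x = ≋-pointwise
    (λ n → solve 2 (λ a b → con 0ℚ :+ a := a) ≡.refl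
      (seq (re x) n) (seq (im x) n))
    (λ n → solve 2 (λ a b → con 0ℚ :+ b := b) ≡.refl
      (seq (re x) n) (seq (im x) n))
    where open +-*-Solver

  ⊖-inverseˡ : ∀ x → ⊖ x ⊕ x ≋ 0ℂ
  ⊖-inverseˡ x = ≋-pointwise
    (λ n → solve 2 (λ a b → (:- a) :+ a := con 0ℚ) ≡.refl
      (seq (re x) n) (seq (im x) n))
    (λ n → solve 2 (λ a b → (:- b) :+ b := con 0ℚ) ≡.refl
      (seq (re x) n) (seq (im x) n))
    where open +-*-Solver

  ⊗-assoc : ∀ x y z → (x ⊗ y) ⊗ z ≋ x ⊗ (y ⊗ z)
  ⊗-assoc x y z = ≋-pointwise
    (λ n → solve 6 (λ a b c d e f → (a :* c :- b :* d) :* e :- (a :* d :+ b :* c) :* f :=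
      a :* (c :* e :- d :* f) :- b :* (c :* f :+ d :* e)) ≡.refl
      (seq (re x) n) (seq (im x) n) (seq (re y) n) (seq (im y) n) (seq (re z) n) (seq (im z) n))
    (λ n → solve 6 (λ a b c d e f → (a :* c :- b :* d) :* f :+ (a :* d :+ b :* c) :* e :=
      a :* (c :* f :+ d :* e) :+ b :* (c :* e :- d :* f)) ≡.refl
      (seq (re x) n) (seq (im x) n) (seq (re y) n) (seq (im y) n) (seq (re z) n) (seq (im z) n))
    where open +-*-Solver

  ⊗-comm : ∀ x y → x ⊗ y ≋ y ⊗ x
  ⊗-comm x y = ≋-pointwise
    (λ n → solve 4 (λ a b c d → a :* c :- b :* d := c :* a :- d :* b) ≡.refl
      (seq (re x) n) (seq (im x) n) (seq (re y) n) (seq (im y) n))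
    (λ n → solve 4 (λ a b c d → a :* d :+ b :* c := c :* b :+ d :* a) ≡.refl
      (seq (re x) n) (seq (im x) n) (seq (re y) n) (seq (im y) n))
    where open +-*-Solver

  ⊗-identityˡ : ∀ x → 1ℂ ⊗ x ≋ x
  ⊗-identityˡ x = ≋-pointwise
    (λ n → solve 2 (λ a b → con 1ℚ :* a :- con 0ℚ :* b := a) ≡.refl
      (seq (re x) n) (seq (im x) n))
    (λ n → solve 2 (λ a b → con 1ℚ :* b :+ con 0ℚ :* a := b) ≡.refl
      (seq (re x) n) (seq (im x) n))
    where open +-*-Solver

  ⊗-distribˡ-⊕ : ∀ x y z → x ⊗ (y ⊕ z) ≋ x ⊗ y ⊕ x ⊗ z
  ⊗-distribˡ-⊕ x y z = ≋-pointwise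
    (λ n → solve 6 (λ a b c d e f → a :* (c :+ e) :- b :* (d :+ f) :=
      (a :* c :- b :* d) :+ (a :* e :- b :* f)) ≡.refl
      (seq (re x) n) (seq (im x) n) (seq (re y) n) (seq (im y) n) (seq (re z) n) (seq (im z) n))
    (λ n → solve 6 (λ a b c d e f → a :* (d :+ f) :+ b :* (c :+ e) :=
      (a :* d :+ b :* c) :+ (a :* f :+ b :* e)) ≡.refl
      (seq (re x) n) (seq (im x) n) (seq (re y) n) (seq (im y) n) (seq (re z) n) (seq (im z) n))
    where open +-*-Solver

⊕-⊗-isCommutativeRing : IsCommutativeRing _≋_ _⊕_ _⊗_ ⊖_ 0ℂ 1ℂ
⊕-⊗-isCommutativeRing = record
  { isRing = record
    { +-isAbelianGroup = record
      { isGroup = record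
        { isMonoid = record
          { isSemigroup = record
            { isMagma = record
              { isEquivalence = ≋-isEquivalence
              ; ∙-cong = ⊕-cong }
            ; assoc = ⊕-assoc }
          ; identity = ⊕-identityˡ , comm∧idˡ⇒idʳ ⊕-comm ⊕-identityˡ }
        ; inverse = ⊖-inverseˡ , comm∧invˡ⇒invʳ ⊕-comm ⊖-inverseˡ
        ; ⁻¹-cong = ⊖-cong }
      ; comm = ⊕-comm }
    ; *-cong = ⊗-cong
    ; *-assoc = ⊗-assoc
    ; *-identity = ⊗-identityˡ , comm∧idˡ⇒idʳ ⊗-comm ⊗-identityˡ
    ; distrib = ⊗-distribˡ-⊕ , comm∧distrˡ⇒distrʳ ⊕-cong ⊗-comm ⊗-distribˡ-⊕ }
  ; *-comm = ⊗-comm }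
  where open import Algebra.Consequences.Setoid ≋-setoid
ℂ-commutativeRing : CommutativeRing _ _
ℂ-commutativeRing = record { isCommutativeRing = ⊕-⊗-isCommutativeRing }

/1-injective : ∀ {a b} → + a ℚ./ 1 ≡ + b ℚ./ 1 → a ≡ b
/1-injective {a} {b} eq = ≡.trans (≡.sym (ℕₚ.*-identityʳ a))
  (≡.trans (ℚₚ.normalize-injective-≃ a b 1 1 eq) (ℕₚ.*-identityʳ b))

-- |z|² w is a combination of the real and imaginary parts of z w.
*ℂ-cancel-≉0 : ∀ {z w} → z *ℂ w ≋ 0ℂ → ¬ z ≋ 0ℂ → w ≋ 0ℂ
*ℂ-cancel-≉0 {z} {w} (mk≋ (p , q)) z≉0 = mk≋ (
  *ℝ-cancel-≉0 {normSq} (Null⇒≈0 (Null-resp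
    (λ n → re-eq (seq (re z) n) (seq (im z) n) (seq (re w) n) (seq (im w) n))
    (Null-+ (Null-* {seq (re z)} (cauchy (re z)) (≈0⇒Null p)) (Null-* {seq (im z)} (cauchy (im z)) (≈0⇒Null q))))) normSq≉0 ,
  *ℝ-cancel-≉0 {normSq} (Null⇒≈0 (Null-resp
    (λ n → im-eq (seq (re z) n) (seq (im z) n) (seq (re w) n) (seq (im w) n))
    (Null-+ (Null-* {seq (re z)} (cauchy (re z)) (≈0⇒Null q)) (Null-neg (Null-* {seq (im z)} (cauchy (im z)) (≈0⇒Null p)))))) normSq≉0)
  where
  open +-*-Solver
  normSq = re z *ℝ re z +ℝ im z *ℝ im z
  normSq≉0 : ¬ normSq ≈ℝ 0ℝ
  normSq≉0 h = z≉0 (mk≋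
    ( Null⇒≈0 (Null-sum-of-squares {seq (re z)} {seq (im z)} (≈0⇒Null h))
    , Null⇒≈0 (Null-sum-of-squares {seq (im z)} {seq (re z)} (Null-resp
        (λ n → ℚₚ.+-comm (seq (re z) n ℚ.* seq (re z) n) (seq (im z) n ℚ.* seq (im z) n)) (≈0⇒Null h)))))
  re-eq = solve 4 (λ a b c d → a :* (a :* c :- b :* d) :+ b :* (a :* d :+ b :* c) :=
    (a :* a :+ b :* b) :* c) ≡.refl
  im-eq = solve 4 (λ a b c d → a :* (a :* d :+ b :* c) :+ :- (b :* (a :* c :- b :* d)) :=
    (a :* a :+ b :* b) :* d) ≡.refl

⊗-cancel-≉0 : ∀ {z w} → z ⊗ w ≋ 0ℂ → ¬ z ≋ 0ℂ → w ≋ 0ℂ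
⊗-cancel-≉0 {z} {w} z⊗w≋0 = *ℂ-cancel-≉0 (subst (_≋ 0ℂ) (≡.sym (⊗-def z w)) z⊗w≋0)

ℕ→ℂ2≋1⊕1 : ℕ→ℂ 2 ≋ 1ℂ ⊕ 1ℂ
ℕ→ℂ2≋1⊕1 = subst (ℕ→ℂ 2 ≋_) (⊕-def 1ℂ 1ℂ) (≋-pointwise (λ n → ≡.refl) (λ n → ≡.refl))

-- The difference is a constant rational sequence, for which being different from 0 does provide a
-- reciprocal.
ℕ→ℂ-difference-invertible : ∀ a b → ¬ a ≡ b → ∃[ r ] (r *ℂ (ℕ→ℂ a +ℂ -ℂ ℕ→ℂ b) ≋ 1ℂ)
ℕ→ℂ-difference-invertible a b a≢b = (ℚ→ℝ (1/ q) +i ℚ→ℝ 0ℚ) , ≋-pointwise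
  (λ n → ≡.trans (solve 2 (λ r q → r :* q :- con 0ℚ :* (con 0ℚ :- con 0ℚ) := r :* q) ≡.refl (1/ q) q)
                 (ℚₚ.*-inverseˡ q))
  (λ n → solve 2 (λ r q → r :* (con 0ℚ :- con 0ℚ) :+ con 0ℚ :* q := con 0ℚ) ≡.refl (1/ q) q)
  where
  open +-*-Solver
  q = (+ a ℚ./ 1) ℚ.- (+ b ℚ./ 1)
  q≢0 : ¬ q ≡ 0ℚ
  q≢0 = λ q≡0 → a≢b (/1-injective (≡.trans
    (solve 2 (λ x y → x := (x :- y) :+ y) ≡.refl (+ a ℚ./ 1) (+ b ℚ./ 1))
    (≡.trans (cong (ℚ._+ (+ b ℚ./ 1)) q≡0) (ℚₚ.+-identityˡ (+ b ℚ./ 1)))))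
  instance
    _ = ℚ.≢-nonZero q≢0

ℕ→ℂ-⊖-invertible : ∀ a b → ¬ a ≡ b → ∃[ r ] (r ⊗ (ℕ→ℂ a ⊕ ⊖ ℕ→ℂ b) ≋ 1ℂ)
ℕ→ℂ-⊖-invertible a b a≢b = proj₁ (ℕ→ℂ-difference-invertible a b a≢b) ,
  subst (_≋ 1ℂ) (opaque-forms _ (ℕ→ℂ a) (ℕ→ℂ b)) (proj₂ (ℕ→ℂ-difference-invertible a b a≢b))
  where
  opaque-forms : ∀ r x y → r *ℂ (x +ℂ -ℂ y) ≡ r ⊗ (x ⊕ ⊖ y)
  opaque-forms r x y = ≡.trans (⊗-def r (x +ℂ -ℂ y))
    (cong (r ⊗_) (≡.trans (⊕-def x (-ℂ y)) (cong (x ⊕_) (⊖-def y))))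

1≉0 : ¬ 1ℂ ≋ 0ℂ
1≉0 (mk≋ (p , _)) = contradiction (proj₂ (close (≈0⇒Null p) 1ℚ (ℚₚ.positive⁻¹ 1ℚ)) _ ℕₚ.≤-refl)
  (ℚₚ.<-irrefl ≡.refl)

conjℂ-0 : conjℂ 0ℂ ≋ 0ℂ
conjℂ-0 = ≋-pointwise (λ n → ≡.refl) (λ n → ≡.refl)

conjℂ-1 : conjℂ 1ℂ ≋ 1ℂ
conjℂ-1 = ≋-pointwise (λ n → ≡.refl) (λ n → ≡.refl)

-- The zeon algebra

open SubsetAlgebra ℂ-commutativeRing
private
  module 𝕂 = CommutativeRing ℂ-commutativeRing
  module 𝕂ₛ = NilSquarePerturbation ℂ-commutativeRing

module ≋-Reasoning where
  open import Relation.Binary.Reasoning.Setoid 𝕂.setoid public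
open import Algebra.Properties.Group 𝕂.+-group using (ε⁻¹≈ε)
open Zeon using (gens; poly)

-- Reading coefficients with another number of generators

extend-0 : ∀ {n N} (I : Subset N) → extend {n} (λ _ → 0ℂ) I ≡ 0ℂ
extend-0 {zero}  []            = ≡.refl
extend-0 {zero}  (outside ∷ I) = extend-0 {zero} I
extend-0 {zero}  (inside  ∷ I) = ≡.refl
extend-0 {suc n} []            = extend-0 {n} []
extend-0 {suc n} (s ∷ I)       = extend-0 {n} I

extend-cong : ∀ {n N} {f g : Subset n → ℂ} → f ≐ g → (I : Subset N) → extend f I ≋ extend g I
extend-cong {zero}  p []            = p []
extend-cong {zero}  p (outside ∷ I) = extend-cong {zero} p I
extend-cong {zero}  p (inside  ∷ I) = 𝕂.refl
extend-cong {suc n} p []            = extend-cong {n} (p ∘ (outside ∷_)) []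
extend-cong {suc n} p (s ∷ I)       = extend-cong {n} (p ∘ (s ∷_)) I

-- The condition on `F` is for the sets that contain a generator beyond those of `f`, where `extend`
-- supplies 0.
extend-map : (F : ℂ → ℂ) → F 0ℂ ≋ 0ℂ → ∀ {n N} (f : Subset n → ℂ) (I : Subset N) →
  extend (λ J → F (f J)) I ≋ F (extend f I)
extend-map F F0 {zero}  f []            = 𝕂.refl
extend-map F F0 {zero}  f (outside ∷ I) = extend-map F F0 {zero} f I
extend-map F F0 {zero}  f (inside  ∷ I) = 𝕂.sym F0
extend-map F F0 {suc n} f []            = extend-map F F0 {n} (f ∘ (outside ∷_)) []
extend-map F F0 {suc n} f (s ∷ I)       = extend-map F F0 {n} (f ∘ (s ∷_)) I

extend-⊕ : ∀ {n N} (f g : Subset n → ℂ) (I : Subset N) →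
  extend (λ J → f J ⊕ g J) I ≋ extend f I ⊕ extend g I
extend-⊕ {zero}  f g []            = 𝕂.refl
extend-⊕ {zero}  f g (outside ∷ I) = extend-⊕ {zero} f g I
extend-⊕ {zero}  f g (inside  ∷ I) = 𝕂.sym (𝕂.+-identityˡ 0ℂ)
extend-⊕ {suc n} f g []            = extend-⊕ {n} (f ∘ (outside ∷_)) (g ∘ (outside ∷_)) []
extend-⊕ {suc n} f g (s ∷ I)       = extend-⊕ {n} (f ∘ (s ∷_)) (g ∘ (s ∷_)) I

extend-⊛ : ∀ {n N} (f g : Subset n → ℂ) (I : Subset N) → extend (f ⊛ g) I ≋ (extend f ⊛ extend g) I
extend-⊛ {zero}  f g []            = 𝕂.refl
extend-⊛ {zero}  f g (outside ∷ I) = extend-⊛ {zero} f g I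
extend-⊛ {zero}  f g (inside  ∷ I) = 𝕂.sym (𝕂.trans
  (𝕂.+-cong (⊛-zeroˡ (λ _ → 𝕂.refl) (extend g) I) (⊛-zeroʳ (λ _ → 𝕂.refl) (extend f) I))
  (𝕂.+-identityˡ 0ℂ))
extend-⊛ {suc n} f g []            = extend-⊛ {n} (f ∘ (outside ∷_)) (g ∘ (outside ∷_)) []
extend-⊛ {suc n} f g (outside ∷ I) = extend-⊛ {n} (f ∘ (outside ∷_)) (g ∘ (outside ∷_)) I
extend-⊛ {suc n} f g (inside  ∷ I) = 𝕂.trans
  (extend-⊕ {n} ((f ∘ (inside ∷_)) ⊛ (g ∘ (outside ∷_))) ((f ∘ (outside ∷_)) ⊛ (g ∘ (inside ∷_))) I)
  (𝕂.+-cong (extend-⊛ {n} (f ∘ (inside  ∷_)) (g ∘ (outside ∷_)) I)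
            (extend-⊛ {n} (f ∘ (outside ∷_)) (g ∘ (inside  ∷_)) I))

⋆≡⊛ : ∀ {n} (f g : Subset n → ℂ) I → (f ⋆ g) I ≡ (f ⊛ g) I
⋆≡⊛ f g []            = ⊗-def (f []) (g [])
⋆≡⊛ f g (outside ∷ I) = ⋆≡⊛ (f ∘ (outside ∷_)) (g ∘ (outside ∷_)) I
⋆≡⊛ f g (inside  ∷ I) = ≡.trans (⊕-def _ _)
  (cong₂ _⊕_ (⋆≡⊛ (f ∘ (inside  ∷_)) (g ∘ (outside ∷_)) I)
             (⋆≡⊛ (f ∘ (outside ∷_)) (g ∘ (inside  ∷_)) I))

extend-+ℂ : ∀ {n N} (f g : Subset n → ℂ) (I : Subset N) →
  extend (λ J → f J +ℂ g J) I ≋ extend f I ⊕ extend g I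
extend-+ℂ {n} f g I = 𝕂.trans
  (extend-cong {n} (λ J → 𝕂.reflexive (⊕-def (f J) (g J))) I) (extend-⊕ {n} f g I)

extend--ℂ : ∀ {n N} (f : Subset n → ℂ) (I : Subset N) → extend (λ J → -ℂ f J) I ≋ ⊖ extend f I
extend--ℂ {n} f I = 𝕂.trans
  (extend-cong {n} (λ J → 𝕂.reflexive (⊖-def (f J))) I) (extend-map ⊖_ ε⁻¹≈ε {n} f I)

extend-⋆ : ∀ {n N} (f g : Subset n → ℂ) (I : Subset N) → extend (f ⋆ g) I ≋ (extend f ⊛ extend g) I
extend-⋆ {n} f g I = 𝕂.trans
  (extend-cong {n} (λ J → 𝕂.reflexive (⋆≡⊛ f g J)) I) (extend-⊛ {n} f g I)

-- The intermediate number of generators must be at least `a`, since a smaller one would truncate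
-- `f`.
extend-extend : ∀ {a n N} → a ℕ.≤ n → (f : Subset a → ℂ) (I : Subset N) →
  extend (extend {a} {n} f) I ≡ extend f I
extend-extend {zero}  {zero}  _         f []            = ≡.refl
extend-extend {zero}  {zero}  p         f (outside ∷ I) = extend-extend {zero} {zero} p f I
extend-extend {zero}  {zero}  _         f (inside  ∷ I) = ≡.refl
extend-extend {zero}  {suc n} _         f []            = extend-extend {zero} {n} z≤n f []
extend-extend {zero}  {suc n} _         f (outside ∷ I) = extend-extend {zero} {n} z≤n f I
extend-extend {zero}  {suc n} _         f (inside  ∷ I) = extend-0 {n} I
extend-extend {suc a} {suc n} (s≤s a≤n) f []            = extend-extend a≤n (f ∘ (outside ∷_)) []
extend-extend {suc a} {suc n} (s≤s a≤n) f (s ∷ I)       = extend-extend a≤n (f ∘ (s ∷_)) I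

extend-⊥ : ∀ {n} N (f : Subset n → ℂ) → extend f (Subset.⊥ {N}) ≡ extend {n} {0} f []
extend-⊥         zero    f = ≡.refl
extend-⊥ {zero}  (suc N) f = extend-⊥ N f
extend-⊥ {suc n} (suc N) f = extend-⊥ N (f ∘ (outside ∷_))

-- The zeons as a commutative ring

≈-intro : ∀ {u v} → (∀ {N} (I : Subset N) → coeff u I ≋ coeff v I) → u ≈ v
≈-intro h = mk≈ λ I → _≋_.pair (h I)

≈-elim : ∀ {u v} → u ≈ v → ∀ {N} (I : Subset N) → coeff u I ≋ coeff v I
≈-elim (mk≈ h) I = mk≋ (h I)

infixl 6 _⊞_
infixl 7 _⊠_
infix  8 ⊟_

opaque
  _⊞_ _⊠_ : Zeon → Zeon → Zeon
  u ⊞ v = u + v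
  u ⊠ v = u * v

  ⊟_ : Zeon → Zeon
  ⊟ u = - u

  ⊞-def : ∀ u v → u + v ≡ u ⊞ v
  ⊞-def u v = ≡.refl

  ⊠-def : ∀ u v → u * v ≡ u ⊠ v
  ⊠-def u v = ≡.refl

  ⊟-def : ∀ u → - u ≡ ⊟ u
  ⊟-def u = ≡.refl

  coeff-⊞ : ∀ u v {N} (I : Subset N) → coeff (u ⊞ v) I ≋ coeff u I ⊕ coeff v I
  coeff-⊞ u v I = 𝕂.trans (extend-+ℂ {gens u ⊔ gens v} (coeff u) (coeff v) I)
    (𝕂.reflexive (cong₂ _⊕_ (extend-extend (ℕₚ.m≤m⊔n (gens u) (gens v)) (poly u) I)
                            (extend-extend (ℕₚ.m≤n⊔m (gens u) (gens v)) (poly v) I)))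

  coeff-⊠ : ∀ u v {N} (I : Subset N) → coeff (u ⊠ v) I ≋ (coeff u ⊛ coeff v) I
  coeff-⊠ u v I = 𝕂.trans (extend-⋆ {gens u ⊔ gens v} (coeff u) (coeff v) I)
    (⊛-cong (λ J → 𝕂.reflexive (extend-extend (ℕₚ.m≤m⊔n (gens u) (gens v)) (poly u) J))
            (λ J → 𝕂.reflexive (extend-extend (ℕₚ.m≤n⊔m (gens u) (gens v)) (poly v) J)) I)

  coeff-⊟ : ∀ u {N} (I : Subset N) → coeff (⊟ u) I ≋ ⊖ coeff u I
  coeff-⊟ u I = extend--ℂ (poly u) I

coeff-ι : ∀ z {N} (I : Subset N) → coeff (ι z) I ≡ scalar z I
coeff-ι z []            = ≡.refl
coeff-ι z (outside ∷ I) = coeff-ι z I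
coeff-ι z (inside  ∷ I) = ≡.refl

coeff-0# : ∀ {N} (I : Subset N) → coeff 0# I ≋ 0ℂ
coeff-0# I = 𝕂.trans (𝕂.reflexive (coeff-ι 0ℂ I)) (scalar-0 I)

≈-isEquivalence : IsEquivalence _≈_
≈-isEquivalence = record
  { refl  = ≈-intro λ I → 𝕂.refl
  ; sym   = λ p → ≈-intro λ I → 𝕂.sym (≈-elim p I)
  ; trans = λ p q → ≈-intro λ I → 𝕂.trans (≈-elim p I) (≈-elim q I)
  }

≈-setoid : Setoid _ _
≈-setoid = record { isEquivalence = ≈-isEquivalence }

⊞-cong : ∀ {u u′ v v′} → u ≈ u′ → v ≈ v′ → u ⊞ v ≈ u′ ⊞ v′
⊞-cong {u} {u′} {v} {v′} p q = ≈-intro λ I → begin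
  coeff (u ⊞ v) I              ≈⟨ coeff-⊞ u v I ⟩
  coeff u I ⊕ coeff v I        ≈⟨ 𝕂.+-cong (≈-elim p I) (≈-elim q I) ⟩
  coeff u′ I ⊕ coeff v′ I      ≈⟨ coeff-⊞ u′ v′ I ⟨
  coeff (u′ ⊞ v′) I            ∎
  where open ≋-Reasoning

⊠-cong : ∀ {u u′ v v′} → u ≈ u′ → v ≈ v′ → u ⊠ v ≈ u′ ⊠ v′
⊠-cong {u} {u′} {v} {v′} p q = ≈-intro λ I → begin
  coeff (u ⊠ v) I              ≈⟨ coeff-⊠ u v I ⟩
  (coeff u ⊛ coeff v) I        ≈⟨ ⊛-cong (≈-elim p) (≈-elim q) I ⟩
  (coeff u′ ⊛ coeff v′) I      ≈⟨ coeff-⊠ u′ v′ I ⟨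
  coeff (u′ ⊠ v′) I            ∎
  where open ≋-Reasoning

⊟-cong : ∀ {u v} → u ≈ v → ⊟ u ≈ ⊟ v
⊟-cong {u} {v} p = ≈-intro λ I → begin
  coeff (⊟ u) I    ≈⟨ coeff-⊟ u I ⟩
  ⊖ coeff u I      ≈⟨ 𝕂.-‿cong (≈-elim p I) ⟩
  ⊖ coeff v I      ≈⟨ coeff-⊟ v I ⟨
  coeff (⊟ v) I    ∎
  where open ≋-Reasoning

⊞-assoc : ∀ u v w → (u ⊞ v) ⊞ w ≈ u ⊞ (v ⊞ w)
⊞-assoc u v w = ≈-intro λ I → begin
  coeff ((u ⊞ v) ⊞ w) I                  ≈⟨ coeff-⊞ (u ⊞ v) w I ⟩
  coeff (u ⊞ v) I ⊕ coeff w I            ≈⟨ 𝕂.+-congʳ (coeff-⊞ u v I) ⟩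
  (coeff u I ⊕ coeff v I) ⊕ coeff w I    ≈⟨ 𝕂.+-assoc _ _ _ ⟩
  coeff u I ⊕ (coeff v I ⊕ coeff w I)    ≈⟨ 𝕂.+-congˡ (coeff-⊞ v w I) ⟨
  coeff u I ⊕ coeff (v ⊞ w) I            ≈⟨ coeff-⊞ u (v ⊞ w) I ⟨
  coeff (u ⊞ (v ⊞ w)) I                  ∎
  where open ≋-Reasoning

⊞-comm : ∀ u v → u ⊞ v ≈ v ⊞ u
⊞-comm u v = ≈-intro λ I → begin
  coeff (u ⊞ v) I          ≈⟨ coeff-⊞ u v I ⟩
  coeff u I ⊕ coeff v I    ≈⟨ 𝕂.+-comm _ _ ⟩
  coeff v I ⊕ coeff u I    ≈⟨ coeff-⊞ v u I ⟨
  coeff (v ⊞ u) I          ∎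
  where open ≋-Reasoning

⊞-identityˡ : ∀ u → 0# ⊞ u ≈ u
⊞-identityˡ u = ≈-intro λ I → begin
  coeff (0# ⊞ u) I          ≈⟨ coeff-⊞ 0# u I ⟩
  coeff 0# I ⊕ coeff u I    ≈⟨ 𝕂.+-congʳ (coeff-0# I) ⟩
  0ℂ ⊕ coeff u I            ≈⟨ 𝕂.+-identityˡ _ ⟩
  coeff u I                 ∎
  where open ≋-Reasoning

⊟-inverseˡ : ∀ u → ⊟ u ⊞ u ≈ 0#
⊟-inverseˡ u = ≈-intro λ I → begin
  coeff (⊟ u ⊞ u) I             ≈⟨ coeff-⊞ (⊟ u) u I ⟩
  coeff (⊟ u) I ⊕ coeff u I     ≈⟨ 𝕂.+-congʳ (coeff-⊟ u I) ⟩
  ⊖ coeff u I ⊕ coeff u I       ≈⟨ 𝕂.-‿inverseˡ _ ⟩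
  0ℂ                            ≈⟨ coeff-0# I ⟨
  coeff 0# I                    ∎
  where open ≋-Reasoning

⊠-assoc : ∀ u v w → (u ⊠ v) ⊠ w ≈ u ⊠ (v ⊠ w)
⊠-assoc u v w = ≈-intro λ I → begin
  coeff ((u ⊠ v) ⊠ w) I                ≈⟨ coeff-⊠ (u ⊠ v) w I ⟩
  (coeff (u ⊠ v) ⊛ coeff w) I          ≈⟨ ⊛-cong (coeff-⊠ u v) (λ _ → 𝕂.refl) I ⟩
  ((coeff u ⊛ coeff v) ⊛ coeff w) I    ≈⟨ ⊛-assoc (coeff u) (coeff v) (coeff w) I ⟩
  (coeff u ⊛ (coeff v ⊛ coeff w)) I    ≈⟨ ⊛-cong (λ _ → 𝕂.refl) (coeff-⊠ v w) I ⟨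
  (coeff u ⊛ coeff (v ⊠ w)) I          ≈⟨ coeff-⊠ u (v ⊠ w) I ⟨
  coeff (u ⊠ (v ⊠ w)) I                ∎
  where open ≋-Reasoning

⊠-comm : ∀ u v → u ⊠ v ≈ v ⊠ u
⊠-comm u v = ≈-intro λ I → begin
  coeff (u ⊠ v) I          ≈⟨ coeff-⊠ u v I ⟩
  (coeff u ⊛ coeff v) I    ≈⟨ ⊛-comm (coeff u) (coeff v) I ⟩
  (coeff v ⊛ coeff u) I    ≈⟨ coeff-⊠ v u I ⟨
  coeff (v ⊠ u) I          ∎
  where open ≋-Reasoning

coeff-ι-⊠ : ∀ z u {N} (I : Subset N) → coeff (ι z ⊠ u) I ≋ z ⊗ coeff u I
coeff-ι-⊠ z u I = begin
  coeff (ι z ⊠ u) I            ≈⟨ coeff-⊠ (ι z) u I ⟩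
  (coeff (ι z) ⊛ coeff u) I    ≈⟨ ⊛-cong (λ J → 𝕂.reflexive (coeff-ι z J)) (λ _ → 𝕂.refl) I ⟩
  (scalar z ⊛ coeff u) I       ≈⟨ scalar-⊛ z (coeff u) I ⟩
  z ⊗ coeff u I                ∎
  where open ≋-Reasoning

⊠-identityˡ : ∀ u → ι 1ℂ ⊠ u ≈ u
⊠-identityˡ u = ≈-intro λ I → 𝕂.trans (coeff-ι-⊠ 1ℂ u I) (𝕂.*-identityˡ _)

⊠-distribˡ-⊞ : ∀ u v w → u ⊠ (v ⊞ w) ≈ u ⊠ v ⊞ u ⊠ w
⊠-distribˡ-⊞ u v w = ≈-intro λ I → begin
  coeff (u ⊠ (v ⊞ w)) I                              ≈⟨ coeff-⊠ u (v ⊞ w) I ⟩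
  (coeff u ⊛ coeff (v ⊞ w)) I                        ≈⟨ ⊛-cong (λ _ → 𝕂.refl) (coeff-⊞ v w) I ⟩
  (coeff u ⊛ (λ J → coeff v J ⊕ coeff w J)) I        ≈⟨ ⊛-distribˡ-+ (coeff u) (coeff v) (coeff w) I ⟩
  (coeff u ⊛ coeff v) I ⊕ (coeff u ⊛ coeff w) I      ≈⟨ 𝕂.+-cong (coeff-⊠ u v I) (coeff-⊠ u w I) ⟨
  coeff (u ⊠ v) I ⊕ coeff (u ⊠ w) I                  ≈⟨ coeff-⊞ (u ⊠ v) (u ⊠ w) I ⟨
  coeff (u ⊠ v ⊞ u ⊠ w) I                            ∎
  where open ≋-Reasoning

zeon-commutativeRing : CommutativeRing _ _
zeon-commutativeRing = record
  { Carrier = Zeon ; _≈_ = _≈_ ; _+_ = _⊞_ ; _*_ = _⊠_ ; -_ = ⊟_ ; 0# = 0# ; 1# = ι 1ℂ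
  ; isCommutativeRing = record
    { isRing = record
      { +-isAbelianGroup = record
        { isGroup = record
          { isMonoid = record
            { isSemigroup = record
              { isMagma = record { isEquivalence = ≈-isEquivalence ; ∙-cong = ⊞-cong }
              ; assoc = ⊞-assoc }
            ; identity = ⊞-identityˡ , comm∧idˡ⇒idʳ ⊞-comm ⊞-identityˡ }
          ; inverse = ⊟-inverseˡ , comm∧invˡ⇒invʳ ⊞-comm ⊟-inverseˡ
          ; ⁻¹-cong = ⊟-cong }
        ; comm = ⊞-comm }
      ; *-cong = ⊠-cong
      ; *-assoc = ⊠-assoc
      ; *-identity = ⊠-identityˡ , comm∧idˡ⇒idʳ ⊠-comm ⊠-identityˡ
      ; distrib = ⊠-distribˡ-⊞ , comm∧distrˡ⇒distrʳ ⊞-cong ⊠-comm ⊠-distribˡ-⊞ }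
    ; *-comm = ⊠-comm } }
  where open import Algebra.Consequences.Setoid ≈-setoid

private
  module 𝕫 = CommutativeRing zeon-commutativeRing
  module 𝕫ₛ = NilSquarePerturbation zeon-commutativeRing
  module 𝕃 = ZeonLaplacian zeon-commutativeRing

open 𝕫ₛ using (_∙_; _ᵀ)

module ≈-Reasoning where
  open import Relation.Binary.Reasoning.Setoid 𝕫.setoid public

-- Scalar parts, cancellation, nilsquares and conjugation

ι-cong : ∀ {z w} → z ≋ w → ι z ≈ ι w
ι-cong {z} {w} p = ≈-intro λ I → begin
  coeff (ι z) I    ≡⟨ coeff-ι z I ⟩
  scalar z I       ≈⟨ scalar-cong p I ⟩
  scalar w I       ≡⟨ coeff-ι w I ⟨
  coeff (ι w) I    ∎
  where open ≋-Reasoning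

ι-⊕ : ∀ z w → ι (z ⊕ w) ≈ ι z ⊞ ι w
ι-⊕ z w = ≈-intro λ I → begin
  coeff (ι (z ⊕ w)) I              ≡⟨ coeff-ι (z ⊕ w) I ⟩
  scalar (z ⊕ w) I                 ≈⟨ scalar-+ z w I ⟩
  scalar z I ⊕ scalar w I          ≡⟨ cong₂ _⊕_ (coeff-ι z I) (coeff-ι w I) ⟨
  coeff (ι z) I ⊕ coeff (ι w) I    ≈⟨ coeff-⊞ (ι z) (ι w) I ⟨
  coeff (ι z ⊞ ι w) I              ∎
  where open ≋-Reasoning

ι-⊖ : ∀ z → ι (⊖ z) ≈ ⊟ ι z
ι-⊖ z = ≈-intro λ I → begin
  coeff (ι (⊖ z)) I    ≡⟨ coeff-ι (⊖ z) I ⟩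
  scalar (⊖ z) I       ≈⟨ scalar-neg z I ⟩
  ⊖ scalar z I         ≡⟨ cong ⊖_ (coeff-ι z I) ⟨
  ⊖ coeff (ι z) I      ≈⟨ coeff-⊟ (ι z) I ⟨
  coeff (⊟ ι z) I      ∎
  where open ≋-Reasoning

ι-⊗ : ∀ z w → ι (z ⊗ w) ≈ ι z ⊠ ι w
ι-⊗ z w = ≈-intro λ I → begin
  coeff (ι (z ⊗ w)) I    ≡⟨ coeff-ι (z ⊗ w) I ⟩
  scalar (z ⊗ w) I       ≈⟨ scalar-* z w I ⟩
  z ⊗ scalar w I         ≡⟨ cong (z ⊗_) (coeff-ι w I) ⟨
  z ⊗ coeff (ι w) I      ≈⟨ coeff-ι-⊠ z (ι w) I ⟨
  coeff (ι z ⊠ ι w) I    ∎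
  where open ≋-Reasoning

𝔠-cong : ∀ {u v} → u ≈ v → 𝔠 u ≋ 𝔠 v
𝔠-cong p = ≈-elim p []

𝔠-⊞ : ∀ u v → 𝔠 (u ⊞ v) ≋ 𝔠 u ⊕ 𝔠 v
𝔠-⊞ u v = coeff-⊞ u v []

𝔠-⊠ : ∀ u v → 𝔠 (u ⊠ v) ≋ 𝔠 u ⊗ 𝔠 v
𝔠-⊠ u v = coeff-⊠ u v []

𝔠-map : (F : ℂ → ℂ) → F 0ℂ ≋ 0ℂ → ∀ u →
  extend {Zeon.gens u} {0} (λ I → F (Zeon.poly u I)) [] ≋ F (𝔠 u)
𝔠-map F F0 u = extend-map F F0 {Zeon.gens u} {0} (Zeon.poly u) []

𝔠-conj : ∀ u → 𝔠 (conj u) ≋ conjℂ (𝔠 u)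
𝔠-conj = 𝔠-map conjℂ conjℂ-0

𝔠-sum : ∀ {m} (f : Vector Zeon m) → 𝔠 (𝕫ₛ.sum f) ≋ 𝕂ₛ.sum (𝔠 ∘ f)
𝔠-sum {zero}  f = 𝕂.refl
𝔠-sum {suc m} f = 𝕂.trans (𝔠-⊞ (f zero) (𝕫ₛ.sum (f ∘ suc))) (𝕂.+-congˡ (𝔠-sum (f ∘ suc)))

foldr-cong : ∀ {A B : Set} {_∙_ _∘_ : A → B → B} → (∀ x y → x ∙ y ≡ x ∘ y) →
  ∀ e {m} (f : Vector A m) → foldr _∙_ e f ≡ foldr _∘_ e f
foldr-cong             eq e {zero}  f = ≡.refl
foldr-cong {_∘_ = _∘_} eq e {suc m} f = ≡.trans (eq (f zero) _) (cong (f zero ∘_) (foldr-cong eq e (tail f)))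

∑≡sum : ∀ {m} (f : Vector Zeon m) → ∑ f ≡ 𝕫ₛ.sum f
∑≡sum = foldr-cong {_∙_ = _+_} {_⊞_} ⊞-def 0#

⊠-cancel-𝔠≉0 : ∀ {u v} → u ⊠ v ≈ 0# → ¬ 𝔠 u ≋ 0ℂ → v ≈ 0#
⊠-cancel-𝔠≉0 {u} {v} uv≈0 𝔠u≉0 = ≈-intro λ {N} I → 𝕂.trans
  (⊛-cancel-≉0 ⊗-cancel-≉0 (coeff u) (coeff v)
    (λ J → 𝕂.trans (𝕂.sym (coeff-⊠ u v J)) (𝕂.trans (≈-elim uv≈0 J) (coeff-0# J)))
    (λ p → 𝔠u≉0 (subst (_≋ 0ℂ) (extend-⊥ N (Zeon.poly u)) p)) I)
  (𝕂.sym (coeff-0# I))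

indicator : ∀ {n} → Subset n → Subset n → ℂ
indicator I J = if does (≡-dec _≟ᵇ_ J I) then 1ℂ else 0ℂ

-- In a splitting of `J` into disjoint parts, generator `i` cannot lie in both, so in every summand
-- one of the two indicators is 0.
indicator-⁅⁆-nilsquare : ∀ {n} (i : Fin n) J → (indicator ⁅ i ⁆ ⊛ indicator ⁅ i ⁆) J ≋ 0ℂ
indicator-⁅⁆-nilsquare zero    (outside ∷ J) = ⊛-zeroˡ (λ _ → 𝕂.refl) (λ _ → 0ℂ) J
indicator-⁅⁆-nilsquare zero    (inside  ∷ J) = 𝕂.trans
  (𝕂.+-cong (⊛-zeroʳ (λ _ → 𝕂.refl) (indicator ⁅ zero ⁆ ∘ (inside ∷_)) J)
            (⊛-zeroˡ (λ _ → 𝕂.refl) (indicator ⁅ zero ⁆ ∘ (inside ∷_)) J))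
  (𝕂.+-identityˡ 0ℂ)
indicator-⁅⁆-nilsquare (suc i) (outside ∷ J) = indicator-⁅⁆-nilsquare i J
indicator-⁅⁆-nilsquare (suc i) (inside  ∷ J) = 𝕂.trans
  (𝕂.+-cong (⊛-zeroˡ (λ _ → 𝕂.refl) (indicator ⁅ i ⁆) J)
            (⊛-zeroʳ (λ _ → 𝕂.refl) (indicator ⁅ i ⁆) J))
  (𝕂.+-identityˡ 0ℂ)

ζ-nilsquare : ∀ {n} (i : Fin n) → ζ ⁅ i ⁆ ⊠ ζ ⁅ i ⁆ ≈ 0#
ζ-nilsquare {n} i = ≈-intro λ I → begin
  coeff (ζ ⁅ i ⁆ ⊠ ζ ⁅ i ⁆) I                       ≈⟨ coeff-⊠ (ζ ⁅ i ⁆) (ζ ⁅ i ⁆) I ⟩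
  (coeff (ζ ⁅ i ⁆) ⊛ coeff (ζ ⁅ i ⁆)) I             ≈⟨ extend-⊛ (indicator ⁅ i ⁆) (indicator ⁅ i ⁆) I ⟨
  extend (indicator ⁅ i ⁆ ⊛ indicator ⁅ i ⁆) I      ≈⟨ extend-cong (indicator-⁅⁆-nilsquare i) I ⟩
  extend {n} (λ _ → 0ℂ) I                           ≡⟨ extend-0 {n} I ⟩
  0ℂ                                                ≈⟨ coeff-0# I ⟨
  coeff 0# I                                        ∎
  where open ≋-Reasoning

𝔠-ζ : ∀ {n} (i : Fin n) → 𝔠 (ζ ⁅ i ⁆) ≋ 0ℂ
𝔠-ζ {suc n} zero    = 𝕂.reflexive (extend-0 {n} [])
𝔠-ζ         (suc i) = 𝔠-ζ i

𝔠-ζ⊠ : ∀ {n} (i : Fin n) u → 𝔠 (ζ ⁅ i ⁆ ⊠ u) ≋ 0ℂ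
𝔠-ζ⊠ i u = 𝕂.trans (𝔠-⊠ (ζ ⁅ i ⁆) u) (𝕂.trans (𝕂.*-congʳ (𝔠-ζ i)) (𝕂.zeroˡ (𝔠 u)))

conj-fixed : ∀ u → (∀ I → conjℂ (Zeon.poly u I) ≋ Zeon.poly u I) → conj u ≈ u
conj-fixed u p = ≈-intro λ I → extend-cong {Zeon.gens u} p I

-- For a variable F, conversion checking has no Cauchy proofs to unfold.
ζ-fixed : ∀ {n} (F : ℂ → ℂ) → F 1ℂ ≋ 1ℂ → F 0ℂ ≋ 0ℂ → (I J : Subset n) →
  F (Zeon.poly (ζ I) J) ≋ Zeon.poly (ζ I) J
ζ-fixed F F1 F0 I J with does (≡-dec _≟ᵇ_ J I)
... | true  = F1
... | false = F0

0#-fixed : (F : ℂ → ℂ) → F 0ℂ ≋ 0ℂ → ∀ I → F (Zeon.poly 0# I) ≋ Zeon.poly 0# I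
0#-fixed F F0 I = F0

conj-ζ : ∀ {n} (I : Subset n) → conj (ζ I) ≈ ζ I
conj-ζ I = conj-fixed (ζ I) (ζ-fixed conjℂ conjℂ-1 conjℂ-0 I)

conj-0# : conj 0# ≈ 0#
conj-0# = conj-fixed 0# (0#-fixed conjℂ conjℂ-0)

split-at : ∀ {p n} {P : Fin n → Set p} v → P v → (∀ w → w ≢ v → P w) → ∀ w → P w
split-at v Pv P w with w ≟ v
... | yes ≡.refl = Pv
... | no  w≢v    = P w w≢v

𝔠-†· : ∀ {m} (ξ : Vector Zeon m) → 𝔠 (ξ †· ξ) ≋ 𝕂ₛ.sum (λ i → conjℂ (𝔠 (ξ i)) ⊗ 𝔠 (ξ i))
𝔠-†· {m} ξ = 𝕂.trans (𝕂.reflexive (cong 𝔠 (∑≡sum (λ i → conj (ξ i) * ξ i))))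
  (𝕂.trans (𝔠-sum (λ i → conj (ξ i) * ξ i)) (𝕂ₛ.sum-cong-≋ {m} (λ i → 𝕂.trans
    (𝕂.trans (𝕂.reflexive (cong 𝔠 (⊠-def (conj (ξ i)) (ξ i)))) (𝔠-⊠ (conj (ξ i)) (ξ i)))
    (𝕂.*-congʳ (𝔠-conj (ξ i))))))

-- The normalisation shared by `q` and `η`: pairing with such a vector reads off the scalar part at
-- `v`.
ScalarUnit : ∀ {m} → Fin m → Vector Zeon m → Set
ScalarUnit v ξ = 𝔠 (ξ v) ≋ 1ℂ × (∀ w → w ≢ v → 𝔠 (ξ w) ≋ 0ℂ)

scalarUnit-∙ : ∀ {m} (v : Fin m) (q ξ : Vector Zeon m) → ScalarUnit v q →
  𝔠 (𝕫ₛ.sum (λ i → q i ⊠ ξ i)) ≋ 𝔠 (ξ v)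
scalarUnit-∙ {m} v q ξ (qv≋1 , qw≋0) = 𝕂.trans (𝔠-sum (λ i → q i ⊠ ξ i))
  (𝕂.trans (𝕂ₛ.sum-cong-≋ {m} (λ i → 𝕂.trans (𝔠-⊠ (q i) (ξ i)) (pointwise i)))
    (𝕂ₛ.sum-if-≟ v (𝔠 ∘ ξ)))
  where
  pointwise : ∀ i → 𝔠 (q i) ⊗ 𝔠 (ξ i) ≋ (if does (v ≟ i) then 𝔠 (ξ i) else 0ℂ)
  pointwise i = 𝕂ₛ.if-≟-intro
    (λ v≡i → 𝕂.trans (𝕂.*-congʳ (subst (λ j → 𝔠 (q j) ≋ 1ℂ) v≡i qv≋1)) (𝕂.*-identityˡ _))
    (λ v≢i → 𝕂.trans (𝕂.*-congʳ (qw≋0 i (v≢i ∘ ≡.sym))) (𝕂.zeroˡ _))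

scalarUnit⇒nonNull : ∀ {m} (v : Fin m) (ξ : Vector Zeon m) → ScalarUnit v ξ → NonNull ξ
scalarUnit⇒nonNull {m} v ξ (ξv≋1 , ξw≋0) null = 1≉0 (begin
  1ℂ                                                      ≈⟨ 𝕂ₛ.sum-if-≟ v (λ _ → 1ℂ) ⟨
  𝕂ₛ.sum (λ i → if does (v ≟ i) then 1ℂ else 0ℂ)          ≈⟨ 𝕂ₛ.sum-cong-≋ {m} pointwise ⟨
  𝕂ₛ.sum (λ i → conjℂ (𝔠 (ξ i)) ⊗ 𝔠 (ξ i))                ≈⟨ 𝔠-†· ξ ⟨
  𝔠 (ξ †· ξ)                                              ≈⟨ mk≋ null ⟩
  0ℂ                                                      ∎)
  where
  open ≋-Reasoning
  pointwise : ∀ i → conjℂ (𝔠 (ξ i)) ⊗ 𝔠 (ξ i) ≋ (if does (v ≟ i) then 1ℂ else 0ℂ)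
  pointwise i = 𝕂ₛ.if-≟-intro
    (λ v≡i → let ξi≋1 = subst (λ j → 𝔠 (ξ j) ≋ 1ℂ) v≡i ξv≋1 in
      𝕂.trans (𝕂.*-cong (𝕂.trans (conjℂ-cong ξi≋1) conjℂ-1) ξi≋1) (𝕂.*-identityˡ 1ℂ))
    (λ v≢i → 𝕂.trans (𝕂.*-congˡ (ξw≋0 i (v≢i ∘ ≡.sym))) (𝕂.zeroʳ (conjℂ (𝔠 (ξ i)))))

nonNull⇒scalar≉0 : ∀ {m} (v : Fin m) (ξ : Vector Zeon m) → NonNull ξ →
  (∀ w → w ≢ v → 𝔠 (ξ w) ≋ 0ℂ) → ¬ 𝔠 (ξ v) ≋ 0ℂ
nonNull⇒scalar≉0 {m} v ξ nonNull ξw≋0 ξv≋0 = nonNull (_≋_.pair (begin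
  𝔠 (ξ †· ξ)                                ≈⟨ 𝔠-†· ξ ⟩
  𝕂ₛ.sum (λ i → conjℂ (𝔠 (ξ i)) ⊗ 𝔠 (ξ i))  ≈⟨ 𝕂ₛ.sum-cong-≋ {m} (λ i → 𝕂.trans (𝕂.*-congˡ (ξ≋0 i)) (𝕂.zeroʳ _)) ⟩
  𝕂ₛ.sum {m} (λ _ → 0ℂ)                     ≈⟨ 𝕂ₛ.sum-replicate-zero m ⟩
  0ℂ                                        ∎))
  where
  open ≋-Reasoning
  ξ≋0 : ∀ i → 𝔠 (ξ i) ≋ 0ℂ
  ξ≋0 = split-at v ξv≋0 ξw≋0

-- Eigenvalues

scalars-∙ : ∀ {m} {M : Matrix m} {D : Fin m → ℂ} → (∀ i j → 𝔠 (M i j) ≋ 𝕂ₛ.diagonal D i j) →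
  ∀ ξ i → 𝔠 ((M ∙ ξ) i) ≋ D i ⊗ 𝔠 (ξ i)
scalars-∙ {m} {M} {D} 𝔠M ξ i = 𝕂.trans (𝔠-sum (λ j → M i j ⊠ ξ j))
  (𝕂.trans (𝕂ₛ.sum-cong-≋ {m} (λ j → 𝕂.trans (𝔠-⊠ (M i j) (ξ j)) (𝕂.*-congʳ (𝔠M i j))))
    (𝕂ₛ.diagonal-∙ D (𝔠 ∘ ξ) i))

-- Scalar parts turn the eigenvector equation into one for the diagonal matrix `D`, hence
-- `(D w - D v) 𝔠 (ξ w) = 0`, and the first factor is invertible.
scalar-eigenvector : ∀ {m} {M : Matrix m} {D : Fin m → ℂ} {v w} {ξ : Vector Zeon m} {μ} →
  (∀ i j → 𝔠 (M i j) ≋ 𝕂ₛ.diagonal D i j) → (∀ i → (M ∙ ξ) i ≈ μ ⊠ ξ i) → 𝔠 μ ≋ D v →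
  ∃[ r ] (r ⊗ (D w ⊕ ⊖ D v) ≋ 1ℂ) → 𝔠 (ξ w) ≋ 0ℂ
scalar-eigenvector {M = M} {D} {v} {w} {ξ} {μ} 𝔠M Mξ≈μξ 𝔠μ≋Dv (r , r[Dw-Dv]≋1) = begin
  𝔠 (ξ w)                                        ≈⟨ 𝕂.*-identityˡ _ ⟨
  1ℂ ⊗ 𝔠 (ξ w)                                   ≈⟨ 𝕂.*-congʳ r[Dw-Dv]≋1 ⟨
  r ⊗ (D w ⊕ ⊖ D v) ⊗ 𝔠 (ξ w)                    ≈⟨ 𝕂.*-assoc _ _ _ ⟩
  r ⊗ ((D w ⊕ ⊖ D v) ⊗ 𝔠 (ξ w))                  ≈⟨ 𝕂.*-congˡ (𝕂.distribʳ _ _ _) ⟩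
  r ⊗ (D w ⊗ 𝔠 (ξ w) ⊕ ⊖ D v ⊗ 𝔠 (ξ w))          ≈⟨ 𝕂.*-congˡ (𝕂.+-congʳ Dwξw≋Dvξw) ⟩
  r ⊗ (D v ⊗ 𝔠 (ξ w) ⊕ ⊖ D v ⊗ 𝔠 (ξ w))          ≈⟨ 𝕂.*-congˡ (𝕂.distribʳ _ _ _) ⟨
  r ⊗ ((D v ⊕ ⊖ D v) ⊗ 𝔠 (ξ w))                  ≈⟨ 𝕂.*-congˡ (𝕂.*-congʳ (𝕂.-‿inverseʳ _)) ⟩
  r ⊗ (0ℂ ⊗ 𝔠 (ξ w))                             ≈⟨ 𝕂.*-congˡ (𝕂.zeroˡ _) ⟩
  r ⊗ 0ℂ                                         ≈⟨ 𝕂.zeroʳ r ⟩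
  0ℂ                                             ∎
  where
  open ≋-Reasoning
  Dwξw≋Dvξw : D w ⊗ 𝔠 (ξ w) ≋ D v ⊗ 𝔠 (ξ w)
  Dwξw≋Dvξw = begin
    D w ⊗ 𝔠 (ξ w)       ≈⟨ scalars-∙ {M = M} 𝔠M ξ w ⟨
    𝔠 ((M ∙ ξ) w)       ≈⟨ 𝔠-cong (Mξ≈μξ w) ⟩
    𝔠 (μ ⊠ ξ w)         ≈⟨ 𝔠-⊠ μ (ξ w) ⟩
    𝔠 μ ⊗ 𝔠 (ξ w)       ≈⟨ 𝕂.*-congʳ 𝔠μ≋Dv ⟩
    D v ⊗ 𝔠 (ξ w)       ∎

left-eigenvector⇒unique : ∀ {m} {M : Matrix m} {D : Fin m → ℂ} {v} {q ξ : Vector Zeon m} {λ₁ λ₂} →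
  (∀ i j → 𝔠 (M i j) ≋ 𝕂ₛ.diagonal D i j) →
  (∀ w → w ≢ v → ∃[ r ] (r ⊗ (D w ⊕ ⊖ D v) ≋ 1ℂ)) →
  ScalarUnit v q → (∀ i → (M ᵀ ∙ q) i ≈ λ₁ ⊠ q i) →
  NonNull ξ → (∀ i → (M ∙ ξ) i ≈ λ₂ ⊠ ξ i) → 𝔠 λ₂ ≋ D v → λ₂ ≈ λ₁
left-eigenvector⇒unique {m} {M} {v = v} {q} {ξ} {λ₁} {λ₂} 𝔠M inv unit qM nonNull Mξ 𝔠λ₂ =
  x∙y⁻¹≈ε⇒x≈y λ₂ λ₁ (⊠-cancel-𝔠≉0 (begin
    qξ ⊠ (λ₂ ⊞ ⊟ λ₁)         ≈⟨ 𝕫.distribˡ qξ λ₂ (⊟ λ₁) ⟩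
    qξ ⊠ λ₂ ⊞ qξ ⊠ ⊟ λ₁      ≈⟨ 𝕫.+-congʳ (𝕫.trans (𝕫.*-comm qξ λ₂) (𝕫.trans
                                   (𝕫ₛ.left-right-eigen M qM Mξ) (𝕫.*-comm λ₁ qξ))) ⟩
    qξ ⊠ λ₁ ⊞ qξ ⊠ ⊟ λ₁      ≈⟨ 𝕫.distribˡ qξ λ₁ (⊟ λ₁) ⟨
    qξ ⊠ (λ₁ ⊞ ⊟ λ₁)         ≈⟨ 𝕫.*-congˡ (𝕫.-‿inverseʳ λ₁) ⟩
    qξ ⊠ 0#                  ≈⟨ 𝕫.zeroʳ qξ ⟩
    0#                       ∎)
    (λ 𝔠qξ≋0 → nonNull⇒scalar≉0 v ξ nonNull
      (λ w w≢v → scalar-eigenvector {M = M} 𝔠M Mξ 𝔠λ₂ (inv w w≢v))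
      (𝕂.trans (𝕂.sym (scalarUnit-∙ v q ξ unit)) 𝔠qξ≋0)))
  where
  open ≈-Reasoning
  open import Algebra.Properties.Group 𝕫.+-group using (x∙y⁻¹≈ε⇒x≈y)
  qξ : Zeon
  qξ = 𝕫ₛ.sum (λ i → q i ⊠ ξ i)

-- From the Laplacians of a graph to the abstract setting

*ᵛ-∙ : ∀ {m} {A M : Matrix m} → (∀ i j → A i j ≈ M i j) → ∀ ξ i → (A *ᵛ ξ) i ≈ (M ∙ ξ) i
*ᵛ-∙ {m} {A} A≈M ξ i = 𝕫.trans (𝕫.reflexive (∑≡sum (λ j → A i j * ξ j)))
  (𝕫ₛ.sum-cong-≋ {m} (λ j → 𝕫.trans (𝕫.reflexive (⊠-def (A i j) (ξ j))) (𝕫.*-congʳ (A≈M i j))))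

eigenvalue⇒ : ∀ {m} {A M : Matrix m} {u} → (∀ i j → A i j ≈ M i j) → IsEigenvalue A u →
  ∃[ ξ ] (NonNull {m} ξ × (∀ i → (M ∙ ξ) i ≈ u ⊠ ξ i))
eigenvalue⇒ {u = u} A≈M (ξ , nonNull , Aξ≈uξ) = ξ , nonNull , λ i →
  𝕫.trans (𝕫.sym (*ᵛ-∙ A≈M ξ i)) (𝕫.trans (Aξ≈uξ i) (𝕫.reflexive (⊠-def u (ξ i))))

eigenvalue⇐ : ∀ {m} {A M : Matrix m} {u} {ξ : Vector Zeon m} → (∀ i j → A i j ≈ M i j) → NonNull ξ →
  (∀ i → (M ∙ ξ) i ≈ u ⊠ ξ i) → IsEigenvalue A u
eigenvalue⇐ {u = u} {ξ} A≈M nonNull Mξ≈uξ = ξ , nonNull , λ i →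
  𝕫.trans (*ᵛ-∙ A≈M ξ i) (𝕫.trans (Mξ≈uξ i) (𝕫.sym (𝕫.reflexive (⊠-def u (ξ i)))))

minus-def : ∀ u v → u - v ≡ u ⊞ ⊟ v
minus-def u v = ≡.trans (⊞-def u (- v)) (cong (u ⊞_) (⊟-def v))

-ᴹ-def : ∀ {m} (A B : Matrix m) i j → (A -ᴹ B) i j ≡ A i j ⊞ ⊟ B i j
-ᴹ-def A B i j = minus-def (A i j) (B i j)

-ᴹ-+ᴹ-def : ∀ {m} (A B C : Matrix m) i j → (A -ᴹ (B +ᴹ C)) i j ≡ A i j ⊞ ⊟ (B i j ⊞ C i j)
-ᴹ-+ᴹ-def A B C i j = ≡.trans (-ᴹ-def A (B +ᴹ C) i j) (cong (λ u → A i j ⊞ ⊟ u) (⊞-def (B i j) (C i j)))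

ι+ι*𝔇-def : ∀ z w u → ι z + ι w * 𝔇 u ≡ ι z ⊞ ι w ⊠ (u ⊞ ⊟ ι (𝔠 u))
ι+ι*𝔇-def z w u = ≡.trans (⊞-def (ι z) (ι w * 𝔇 u)) (cong (ι z ⊞_)
  (≡.trans (⊠-def (ι w) (𝔇 u)) (cong (ι w ⊠_) (minus-def u (ι (𝔠 u))))))

module _ {m} (G : SimpleGraph m) where
  open SimpleGraph G

  -- The operation F stands for conj: see ζ-fixed.
  Ψ-fixed : (F : Zeon → Zeon) → (∀ i → F (ζ ⁅ i ⁆) ≈ ζ ⁅ i ⁆) → F 0# ≈ 0# → ∀ i j → F (Ψ i j) ≈ Ψ i j
  Ψ-fixed F Fζ F0 i j with adj i j
  ... | true  = Fζ j
  ... | false = F0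

  Ψ†≈Ψᵀ : ∀ i j → (Ψ †) i j ≈ Ψ j i
  Ψ†≈Ψᵀ i j = Ψ-fixed conj (λ i → conj-ζ ⁅ i ⁆) conj-0# j i

  module UniqueDegreeVertex (v : Fin m) (unique : HasUniqueDegree v) where

    d : Zeon
    d = ι (ℕ→ℂ (deg v))

    c : Vector Zeon m
    c i = ι (ℕ→ℂ (deg i)) ⊞ ⊟ d

    N : Matrix m
    N i j = if adj i j then ⊟ ι 1ℂ else 0#

    degree-inv : ∀ w → w ≢ v → ∃[ r ] (r ⊗ (ℕ→ℂ (deg w) ⊕ ⊖ ℕ→ℂ (deg v)) ≋ 1ℂ)
    degree-inv w w≢v = ℕ→ℂ-⊖-invertible (deg w) (deg v) (w≢v ∘ unique w)

    c-inv : ∀ w → w ≢ v → ∃[ r ] (r ⊠ c w ≈ ι 1ℂ)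
    c-inv w w≢v = let r , r[w-v]≋1 = degree-inv w w≢v in ι r , (begin
      ι r ⊠ (ι (ℕ→ℂ (deg w)) ⊞ ⊟ d)               ≈⟨ 𝕫.*-congˡ (𝕫.+-congˡ (ι-⊖ (ℕ→ℂ (deg v)))) ⟨
      ι r ⊠ (ι (ℕ→ℂ (deg w)) ⊞ ι (⊖ ℕ→ℂ (deg v)))    ≈⟨ 𝕫.*-congˡ (ι-⊕ (ℕ→ℂ (deg w)) (⊖ ℕ→ℂ (deg v))) ⟨
      ι r ⊠ ι (ℕ→ℂ (deg w) ⊕ ⊖ ℕ→ℂ (deg v))          ≈⟨ ι-⊗ r (ℕ→ℂ (deg w) ⊕ ⊖ ℕ→ℂ (deg v)) ⟨
      ι (r ⊗ (ℕ→ℂ (deg w) ⊕ ⊖ ℕ→ℂ (deg v)))          ≈⟨ ι-cong r[w-v]≋1 ⟩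
      ι 1ℂ                                     ∎)
      where open ≈-Reasoning

    N-sym : ∀ i j → N i j ≈ N j i
    N-sym i j = 𝕫.reflexive (cong (λ b → if b then ⊟ ι 1ℂ else 0#) (symm i j))

    Nvv≈0 : N v v ≈ 0#
    Nvv≈0 = 𝕫.reflexive (cong (λ b → if b then ⊟ ι 1ℂ else 0#) (irrefl v))

    module 𝕌 = 𝕃.UniqueDegree v d c (λ i → ζ ⁅ i ⁆) N c-inv (𝕫.-‿inverseʳ d) ζ-nilsquare N-sym Nvv≈0

    D : Vector Zeon m
    D = 𝕌.D

    D≈deg : ∀ i → D i ≈ ι (ℕ→ℂ (deg i))
    D≈deg i = begin
      d ⊞ (ι (ℕ→ℂ (deg i)) ⊞ ⊟ d)      ≈⟨ 𝕫.+-congˡ (𝕫.+-comm (ι (ℕ→ℂ (deg i))) (⊟ d)) ⟩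
      d ⊞ (⊟ d ⊞ ι (ℕ→ℂ (deg i)))      ≈⟨ 𝕫.+-assoc d (⊟ d) (ι (ℕ→ℂ (deg i))) ⟨
      (d ⊞ ⊟ d) ⊞ ι (ℕ→ℂ (deg i))      ≈⟨ 𝕫.+-congʳ (𝕫.-‿inverseʳ d) ⟩
      0# ⊞ ι (ℕ→ℂ (deg i))             ≈⟨ 𝕫.+-identityˡ (ι (ℕ→ℂ (deg i))) ⟩
      ι (ℕ→ℂ (deg i))                  ∎
      where open ≈-Reasoning

    Λᴿ Λsymᴿ : Matrix m
    Λᴿ    = 𝕃.Λ D (λ i → ζ ⁅ i ⁆) N
    Λsymᴿ = 𝕃.Λsym D (λ i → ζ ⁅ i ⁆) N

    Δ≈ : ∀ i j → Δ i j ≈ 𝕫ₛ.diagonal D i j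
    Δ≈ i j = 𝕫ₛ.if-cong (does (i ≟ j)) (𝕫.sym (D≈deg i))

    ⊟Ψ≈ : ∀ i j → ⊟ Ψ i j ≈ N i j ⊠ ζ ⁅ j ⁆
    ⊟Ψ≈ i j = 𝕃.neg-if (adj i j) (ζ ⁅ j ⁆)

    Λ≈ : ∀ i j → Λ i j ≈ Λᴿ i j
    Λ≈ i j = 𝕫.trans (𝕫.reflexive (-ᴹ-def Δ Ψ i j)) (𝕫.+-cong (Δ≈ i j) (⊟Ψ≈ i j))

    Λsym≈ : ∀ i j → Λsym i j ≈ Λsymᴿ i j
    Λsym≈ i j = begin
      Λsym i j                            ≡⟨ -ᴹ-+ᴹ-def Δ Ψ (Ψ †) i j ⟩
      Δ i j ⊞ ⊟ (Ψ i j ⊞ (Ψ †) i j)       ≈⟨ 𝕫.+-cong (Δ≈ i j) (𝕫.-‿cong (𝕫.+-congˡ (Ψ†≈Ψᵀ i j))) ⟩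
      𝕫ₛ.diagonal D i j ⊞ ⊟ (Ψ i j ⊞ Ψ j i)
        ≈⟨ 𝕫.+-congˡ (⁻¹-∙-comm (Ψ i j) (Ψ j i)) ⟨
      𝕫ₛ.diagonal D i j ⊞ (⊟ Ψ i j ⊞ ⊟ Ψ j i)
        ≈⟨ 𝕫.+-congˡ (𝕫.+-cong (⊟Ψ≈ i j) (⊟Ψ≈ j i)) ⟩
      Λsymᴿ i j                           ∎
      where
      open ≈-Reasoning
      open import Algebra.Properties.AbelianGroup 𝕫.+-abelianGroup using (⁻¹-∙-comm)

    𝔠-if : ∀ b {u z} → 𝔠 u ≋ z → 𝔠 (if b then u else 0#) ≋ (if b then z else 0ℂ)
    𝔠-if true  p = p
    𝔠-if false p = 𝕂.refl

    𝔠-⊞-nil : ∀ {u p z} → 𝔠 u ≋ z → 𝔠 p ≋ 0ℂ → 𝔠 (u ⊞ p) ≋ z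
    𝔠-⊞-nil {u} {p} {z} 𝔠u 𝔠p = 𝕂.trans (𝔠-⊞ u p) (𝕂.trans (𝕂.+-cong 𝔠u 𝔠p) (𝕂.+-identityʳ z))

    𝔠-⊠ζ : ∀ u (i : Fin m) → 𝔠 (u ⊠ ζ ⁅ i ⁆) ≋ 0ℂ
    𝔠-⊠ζ u i = 𝕂.trans (𝔠-cong (𝕫.*-comm u (ζ ⁅ i ⁆))) (𝔠-ζ⊠ i u)

    𝔠-diagonal : ∀ i j → 𝔠 (𝕫ₛ.diagonal D i j) ≋ 𝕂ₛ.diagonal (λ i → ℕ→ℂ (deg i)) i j
    𝔠-diagonal i j = 𝔠-if (does (i ≟ j)) (𝔠-cong (D≈deg i))

    𝔠-Λ : ∀ i j → 𝔠 (Λᴿ i j) ≋ 𝕂ₛ.diagonal (λ i → ℕ→ℂ (deg i)) i j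
    𝔠-Λ i j = 𝔠-⊞-nil (𝔠-diagonal i j) (𝔠-⊠ζ (N i j) j)

    𝔠-Λsym : ∀ i j → 𝔠 (Λsymᴿ i j) ≋ 𝕂ₛ.diagonal (λ i → ℕ→ℂ (deg i)) i j
    𝔠-Λsym i j = 𝔠-⊞-nil (𝔠-diagonal i j) (𝔠-⊞-nil (𝔠-⊠ζ (N i j) j) (𝔠-⊠ζ (N j i) i))

    unit-q : ScalarUnit v 𝕌.q
    unit-q = 𝔠-cong 𝕌.q-v , λ w w≢v → 𝕂.trans (𝔠-cong (𝕌.q-≢ w≢v))
      (𝔠-⊞-nil (𝔠-ζ⊠ w (𝕌.x w)) (𝔠-ζ⊠ v (ζ ⁅ w ⁆ ⊠ 𝕌.y w)))

    unit-η : ScalarUnit v 𝕌.η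
    unit-η = 𝔠-cong 𝕌.η-v , λ w w≢v → 𝕂.trans (𝔠-cong (𝕌.η-≢ w≢v))
      (𝔠-⊞-nil (𝔠-⊞-nil (𝔠-ζ⊠ w (𝕌.x w)) (𝔠-ζ⊠ v (ζ ⁅ w ⁆ ⊠ (𝕌.y w ⊞ 𝕌.y w)))) (𝔠-ζ⊠ v (𝕌.t w)))

    𝔡 λ₁ λ₂ : Zeon
    𝔡  = ζ ⁅ v ⁆ ⊠ 𝕌.g
    λ₁ = d ⊞ 𝔡
    λ₂ = d ⊞ (𝔡 ⊞ 𝔡)

    𝔠-λ₂ : 𝔠 λ₂ ≋ ℕ→ℂ (deg v)
    𝔠-λ₂ = 𝔠-⊞-nil 𝕂.refl (𝔠-⊞-nil (𝔠-ζ⊠ v 𝕌.g) (𝔠-ζ⊠ v 𝕌.g))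

    Λ-eigenvalue-unique : ∀ u → IsEigenvalue Λ u → 𝔠 u ≋ ℕ→ℂ (deg v) → u ≈ λ₁
    Λ-eigenvalue-unique u eig 𝔠u = let ξ , nonNull , Λξ≈uξ = eigenvalue⇒ {A = Λ} {Λᴿ} Λ≈ eig in
      left-eigenvector⇒unique {M = Λᴿ} {λ i → ℕ→ℂ (deg i)} {v} {𝕌.q} {ξ} {λ₁} {u}
        𝔠-Λ degree-inv unit-q 𝕌.Λ-left-eigen nonNull Λξ≈uξ 𝔠u

    Λsym-eigenvalue-unique : ∀ u → IsEigenvalue Λsym u → 𝔠 u ≋ ℕ→ℂ (deg v) → u ≈ λ₂
    Λsym-eigenvalue-unique u eig 𝔠u = let ξ , nonNull , Λξ≈uξ = eigenvalue⇒ {A = Λsym} {Λsymᴿ} Λsym≈ eig in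
      left-eigenvector⇒unique {M = Λsymᴿ} {λ i → ℕ→ℂ (deg i)} {v} {𝕌.η} {ξ} {λ₂} {u}
        𝔠-Λsym degree-inv unit-η 𝕌.Λsym-left-eigen nonNull Λξ≈uξ 𝔠u

    Λsym-eigenvalue : ∀ u → u ≈ λ₂ → IsEigenvalue Λsym u
    Λsym-eigenvalue u u≈λ₂ = eigenvalue⇐ {A = Λsym} {Λsymᴿ} {u} {𝕌.η} Λsym≈ (scalarUnit⇒nonNull v 𝕌.η unit-η)
      (λ i → 𝕫.trans (𝕌.Λsym-eigen i) (𝕫.*-congʳ (𝕫.sym u≈λ₂)))

    doubled : ∀ u → u ≈ λ₁ → 𝔠 u ≋ ℕ→ℂ (deg v) → ι (𝔠 u) + ι (ℕ→ℂ 2) * 𝔇 u ≈ λ₂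
    doubled u u≈λ₁ 𝔠u = 𝕫.trans (𝕫.reflexive (ι+ι*𝔇-def (𝔠 u) (ℕ→ℂ 2) u))
      (𝕃.doubled-difference (𝕫.trans (ι-cong ℕ→ℂ2≋1⊕1) (ι-⊕ 1ℂ 1ℂ)) (ι-cong 𝔠u) u≈λ₁)

theorem4p4 : (m : ℕ) (G : SimpleGraph m) (v : Fin m) →
    SimpleGraph.HasUniqueDegree G v →
    (u : Zeon) →
    IsEigenvalue (SimpleGraph.Λ G) u →
    𝔠 u ≈ℂ ℕ→ℂ (SimpleGraph.deg G v) →
    IsUniqueEigenvalueOver (SimpleGraph.Λsym G) (𝔠 u) (ι (𝔠 u) + ι (ℕ→ℂ 2) * 𝔇 u)
theorem4p4 m G v unique u eig 𝔠u =
    (Λsym-eigenvalue u* u*≈λ₂ , _≋_.pair (𝕂.trans (𝔠-cong u*≈λ₂) (𝕂.trans 𝔠-λ₂ (𝕂.sym 𝔠u≋))))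
  , λ μ μ-eig 𝔠μ → 𝕫.trans (Λsym-eigenvalue-unique μ μ-eig (𝕂.trans (mk≋ 𝔠μ) 𝔠u≋)) (𝕫.sym u*≈λ₂)
  where
  open UniqueDegreeVertex G v unique
  𝔠u≋ : 𝔠 u ≋ ℕ→ℂ (SimpleGraph.deg G v)
  𝔠u≋ = mk≋ 𝔠u
  u* : Zeon
  u* = ι (𝔠 u) + ι (ℕ→ℂ 2) * 𝔇 u
  -- That `u` is an eigenvalue of `Λ` is used to identify it with `λ₁ = d ⊞ 𝔡`; doubling its
  -- nilpotent part `𝔡` then produces `λ₂`.
  u*≈λ₂ : u* ≈ λ₂
  u*≈λ₂ = doubled u (Λ-eigenvalue-unique u eig 𝔠u≋) 𝔠u≋
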